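{- Let $n,d,L$ be positive integers. Let $S_n^{(d,L)}$ be the set of permutations $\pi\in S_n$ that avoid both patterns $d\cdots 1(d+1)$ and $1\cdots(L+1)$, and let $\mathcal{T}_n^{(d,L)}$ be the set of pairs $(P,Q)$ of $(d,L)$-cylindric standard Young tableaux of size $n$ with $\mathrm{sh}(P)=\mathrm{sh}(Q)$. Then there is an explicit bijection $\Phi: S_n^{(d,L)}\to \mathcal{T}_n^{(d,L)}$ such that for every $\pi\in S_n^{(d,L)}$ one has $\pi^{ -1}\in S_n^{(d,L)}$ and, if $\Phi(\pi)=(P,Q)$, then $\Phi(\pi^{ -1})=(Q,P)$.
   Context: A permutation $\pi\in S_n$ (in one-line notation $\pi(1)\cdots\pi(n)$) contains the pattern $1\cdots(L+1)$ if there are indices $i_1<\cdots<i_{L+1}$ with $\pi(i_1)<\cdots<\pi(i_{L+1})$; it contains $d\cdots 1(d+1)$ if there are indices $i_1<\cdots<i_{d+1}$ with $\pi(i_1)>\pi(i_2)>\cdots>\pi(i_d)$ and $\pi(i_{d+1})>\pi(i_1)$. It avoids a pattern if it does not contain it. A partition is a finite weakly decreasing sequence $\lambda=(\lambda_1\ge\cdots\ge\lambda_m)$ of positive integers; we set $\lambda_i=0$ for $i>m$, write $\ell(\lambda)=m$ and $|\lambda|=\sum_i\lambda_i$; $\emptyset$ is the empty partition. A $d$-partition is a partition with $\ell(\lambda)\le d$. For $d$-partitions $\alpha,\beta$, write $\alpha\prec_{(d,L)}\beta$ if $\beta_1\ge\alpha_1\ge\beta_2\ge\alpha_2\ge\cdots\ge\beta_d\ge\alpha_d\ge\beta_1-L$.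 A $(d,L)$-cylindric standard Young tableau of size $n$ is a sequence of $d$-partitions $\emptyset=\lambda^{(0)}\prec_{(d,L)}\lambda^{(1)}\prec_{(d,L)}\cdots\prec_{(d,L)}\lambda^{(n)}$ with $|\lambda^{(i)}|-|\lambda^{(i-1)}|=1$ for all $i$; its shape $\mathrm{sh}$ is $\lambda^{(n)}$. -}

module Defs where

open import Data.Nat using (ℕ; zero; suc; _+_; _∸_; _≤_; _<_; _>_)
open import Data.Fin using (Fin; toℕ; fromℕ) renaming (_<_ to _<ᶠ_)
import Data.Fin as F
open import Data.Vec using (Vec; []; _∷_; lookup; replicate; sum; head)
open import Data.Product using (Σ; _×_; _,_; ∃)
open import Data.Fin.Permutation using (Permutation′; _⟨$⟩ʳ_; flip; _≈_)
open import Relation.Binary.PropositionalEquality using (_≡_)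

-- Permutations and pattern avoidance
-- A permutation π ∈ S_n is a `Permutation′ n`; its one-line notation is
-- π(1)⋯π(n) with π(i) = π ⟨$⟩ʳ i (positions/values 0-indexed in Fin n).

StrictInc : {k n : ℕ} → (Fin k → Fin n) → Set
StrictInc ι = ∀ a b → a <ᶠ b → ι a <ᶠ ι b

ContainsInc : {n : ℕ} → ℕ → Permutation′ n → Set
ContainsInc {n} L π =
  Σ (Fin (suc L) → Fin n) λ ι →
    StrictInc ι × (∀ a b → a <ᶠ b → (π ⟨$⟩ʳ ι a) <ᶠ (π ⟨$⟩ʳ ι b))

ContainsDec1 : {n : ℕ} → ℕ → Permutation′ n → Set
ContainsDec1 {n} d π =
  Σ (Fin (suc d) → Fin n) λ ι →
    StrictInc ι
    × (∀ a b → a <ᶠ b → toℕ b < d → (π ⟨$⟩ʳ ι b) <ᶠ (π ⟨$⟩ʳ ι a))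
    × ((π ⟨$⟩ʳ ι F.zero) <ᶠ (π ⟨$⟩ʳ ι (fromℕ d)))

Avoids : {n : ℕ} → (Permutation′ n → Set) → Permutation′ n → Set
Avoids C π = C π → ⊥'
  where open import Data.Empty renaming (⊥ to ⊥')

InS : (n d L : ℕ) → Permutation′ n → Set
InS n d L π = Avoids (ContainsDec1 d) π × Avoids (ContainsInc L) π

-- d-partitions, represented as length-d vectors (λ₁,…,λ_d) padded by 0

-- 1-indexed part λ_i (λ_i = 0 for i = 0 or i > d)
part : {d : ℕ} → Vec ℕ d → ℕ → ℕ
part xs zero = 0
part [] (suc i) = 0
part (x ∷ xs) (suc zero) = x
part (x ∷ xs) (suc (suc i)) = part xs (suc i)

IsDPartition : {d : ℕ} → Vec ℕ d → Set
IsDPartition {d} λ' = ∀ i → 1 ≤ i → i < d → part λ' (suc i) ≤ part λ' i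

size : {d : ℕ} → Vec ℕ d → ℕ
size = sum

Prec : (d L : ℕ) → Vec ℕ d → Vec ℕ d → Set
Prec d L α β =
  (∀ i → 1 ≤ i → i ≤ d → part α i ≤ part β i)
  × (∀ i → 1 ≤ i → i < d → part β (suc i) ≤ part α i)
  × (part β 1 ∸ L ≤ part α d)

-- (d,L)-cylindric standard Young tableau of size n:
-- λ⁽⁰⁾ = ∅ ≺ λ⁽¹⁾ ≺ ⋯ ≺ λ⁽ⁿ⁾, each a d-partition, sizes increasing by 1.
-- Stored as the vector (λ⁽⁰⁾,…,λ⁽ⁿ⁾) of length n+1.
IsCylSYT : (n d L : ℕ) → Vec (Vec ℕ d) (suc n) → Set
IsCylSYT n d L T =
  lookup T F.zero ≡ replicate d 0
  × (∀ (i : Fin (suc n)) → IsDPartition (lookup T i))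
  × (∀ (i : Fin n) → Prec d L (lookup T (F.inject₁ i)) (lookup T (F.suc i))
       × size (lookup T (F.suc i)) ≡ suc (size (lookup T (F.inject₁ i))))

shape : {n d : ℕ} → Vec (Vec ℕ d) (suc n) → Vec ℕ d
shape {n} T = lookup T (fromℕ n)

TabPair : (n d : ℕ) → Set
TabPair n d = Vec (Vec ℕ d) (suc n) × Vec (Vec ℕ d) (suc n)

InT : (n d L : ℕ) → TabPair n d → Set
InT n d L (P , Q) = IsCylSYT n d L P × IsCylSYT n d L Q × shape P ≡ shape Q

swapPair : {n d : ℕ} → TabPair n d → TabPair n d
swapPair (P , Q) = (Q , P)

{-# OPTIONS --safe #-}

-- Φ is the boundary of a growth diagram in which the row to be incremented is read cyclically mod d:
-- two equal steps in row r < d force a step in row r + 1, and two equal steps in row d force a step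
-- in row 1. A square with forced step 1 can then come from an entry of the permutation matrix or from
-- a step in row d; the two are told apart if entries occur only where the lower left partition λ has
-- λ_d = 0. Moreover the new box of such an entry is legal iff λ₁ < L. As long as λ_d = 0 the diagram
-- is the ordinary one, so by Schensted's theorem (λ₁ is the longest increasing and the number of rows
-- the longest decreasing subsequence) both conditions together say that the entry is not the last
-- letter of a pattern d⋯1(d+1) or 1⋯(L+1). Transposing the diagram inverts the permutation.
module Submission where

open import Defs
open import Data.Nat
open import Data.Nat.Properties
open import Data.Bool using (Bool; true; false; if_then_else_)
open import Data.Fin using (Fin; toℕ; fromℕ; fromℕ<; inject₁) renaming (_<_ to _<ᶠ_)
open import Data.Fin.Properties using (toℕ-inject₁; toℕ-fromℕ; toℕ-fromℕ<; toℕ<n; toℕ-injective; any?)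
open import Data.Fin.Relation.Unary.Top using (view; ‵fromℕ; ‵inject₁)
open import Data.Fin.Permutation using (Permutation′; _⟨$⟩ʳ_; _⟨$⟩ˡ_; flip; permutation; inverseˡ; inverseʳ; _≈_)
open import Data.Product using (Σ; ∃; _×_; _,_; proj₁; proj₂; uncurry)
open import Data.Product.Properties using (≡-dec; ,-injective)
open import Data.Sum using (_⊎_; inj₁; inj₂)
open import Data.Vec using (Vec; []; _∷_; replicate; sum; tabulate; lookup)
open import Data.Vec.Properties using (∷-injectiveˡ; ∷-injectiveʳ; lookup∘tabulate; tabulate-cong; tabulate∘lookup)
open import Data.Empty using (⊥)
open import Function using (_∘_)
open import Relation.Nullary using (¬_; yes; no; does; contradiction)
open import Relation.Unary using (Decidable)
open import Relation.Binary.Definitions using (tri<; tri≈; tri>)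
open import Relation.Binary.PropositionalEquality

-- Pattern avoidance enters only through `SeedCorners`: every permutation has a growth diagram,
-- whether it avoids the patterns or not. Two rigidity facts carry the bijection: the seeds
-- determine the diagram, and under `SeedCorners` the upper and right boundary determine the square
-- that they enclose. `Growth` is therefore a structure with properties rather than one
-- construction: the diagram grown from π, its transpose and the diagram rebuilt from a pair of
-- tableaux can all be compared through their seeds. The obstacle is that wraps add boxes to row 1
-- as well, so that in general λ₁ does not count an increasing subsequence. The parts of Schensted's
-- theorem that wraps would spoil are proved for rectangles without a wrap. An empty row `d` at the
-- upper right corner guarantees such a rectangle, since a wrap needs a box in row `d` and
-- partitions only grow; hence the decreasing pattern is dealt with before the increasing one. For
-- `d = 1` row 1 and row `d` coincide, which accounts for the separate cases `1 ≟ d`.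

-- Vectors of parts

-- Labels are rows numbered from 1; the label 0 stands for "no box added".
inc : ∀ {d} → ℕ → Vec ℕ d → Vec ℕ d
inc zero xs = xs
inc (suc r) [] = []
inc (suc zero) (x ∷ xs) = suc x ∷ xs
inc (suc (suc r)) (x ∷ xs) = x ∷ inc (suc r) xs

part-inc-≡ : ∀ {d} (xs : Vec ℕ d) {r} → suc r ≤ d → part (inc (suc r) xs) (suc r) ≡ suc (part xs (suc r))
part-inc-≡ (x ∷ xs) {zero} _ = refl
part-inc-≡ (x ∷ xs) {suc r} (s≤s r<d) = part-inc-≡ xs r<d

part-inc-≢ : ∀ {d} (xs : Vec ℕ d) {r i} → r ≢ i → part (inc r xs) i ≡ part xs i
part-inc-≢ xs {zero} _ = refl
part-inc-≢ [] {suc r} _ = refl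
part-inc-≢ (x ∷ xs) {suc zero} {zero} _ = refl
part-inc-≢ (x ∷ xs) {suc zero} {suc zero} r≢i = contradiction refl r≢i
part-inc-≢ (x ∷ xs) {suc zero} {suc (suc i)} _ = refl
part-inc-≢ (x ∷ xs) {suc (suc r)} {zero} _ = refl
part-inc-≢ (x ∷ xs) {suc (suc r)} {suc zero} _ = refl
part-inc-≢ (x ∷ xs) {suc (suc r)} {suc (suc i)} r≢i = part-inc-≢ xs (r≢i ∘ cong suc)

part-inc-≤ : ∀ {d} (xs : Vec ℕ d) r i → part xs i ≤ part (inc r xs) i
part-inc-≤ xs zero i = ≤-refl
part-inc-≤ [] (suc r) i = ≤-refl
part-inc-≤ (x ∷ xs) (suc zero) zero = ≤-refl
part-inc-≤ (x ∷ xs) (suc zero) (suc zero) = n≤1+n x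
part-inc-≤ (x ∷ xs) (suc zero) (suc (suc i)) = ≤-refl
part-inc-≤ (x ∷ xs) (suc (suc r)) zero = ≤-refl
part-inc-≤ (x ∷ xs) (suc (suc r)) (suc zero) = ≤-refl
part-inc-≤ (x ∷ xs) (suc (suc r)) (suc (suc i)) = part-inc-≤ xs (suc r) (suc i)

part-inc->⇒≡ : ∀ {d} {xs : Vec ℕ d} {r i} → part xs i < part (inc r xs) i → r ≡ i
part-inc->⇒≡ {xs = xs} {r} {i} lt with r ≟ i
... | yes r≡i = r≡i
... | no r≢i = contradiction (sym (part-inc-≢ xs r≢i)) (<⇒≢ lt)

inc-comm : ∀ {d} a b (xs : Vec ℕ d) → inc a (inc b xs) ≡ inc b (inc a xs)
inc-comm zero b xs = refl
inc-comm (suc a) zero xs = refl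
inc-comm (suc a) (suc b) [] = refl
inc-comm (suc zero) (suc zero) (x ∷ xs) = refl
inc-comm (suc zero) (suc (suc b)) (x ∷ xs) = refl
inc-comm (suc (suc a)) (suc zero) (x ∷ xs) = refl
inc-comm (suc (suc a)) (suc (suc b)) (x ∷ xs) = cong (x ∷_) (inc-comm (suc a) (suc b) xs)

inc-injectiveʳ : ∀ {d} a {xs ys : Vec ℕ d} → inc a xs ≡ inc a ys → xs ≡ ys
inc-injectiveʳ zero eq = eq
inc-injectiveʳ (suc a) {[]} {[]} _ = refl
inc-injectiveʳ (suc zero) {x ∷ xs} {y ∷ ys} eq =
  cong₂ _∷_ (suc-injective (∷-injectiveˡ eq)) (∷-injectiveʳ eq)
inc-injectiveʳ (suc (suc a)) {x ∷ xs} {y ∷ ys} eq =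
  cong₂ _∷_ (∷-injectiveˡ eq) (inc-injectiveʳ (suc a) (∷-injectiveʳ eq))

sum-inc : ∀ {d} (xs : Vec ℕ d) {r} → suc r ≤ d → sum (inc (suc r) xs) ≡ suc (sum xs)
sum-inc (x ∷ xs) {zero} _ = refl
sum-inc (x ∷ xs) {suc r} (s≤s r<d) = trans (cong (x +_) (sum-inc xs r<d)) (+-suc x (sum xs))

sum-inc-injective : ∀ {d} {xs : Vec ℕ d} {r} → r ≤ d → sum (inc r xs) ≡ sum xs → r ≡ 0
sum-inc-injective {r = zero} _ _ = refl
sum-inc-injective {xs = xs} {suc r} r<d eq = contradiction (trans (sym eq) (sum-inc xs r<d)) (1+n≢n ∘ sym)

inc-injectiveˡ : ∀ {d} {xs : Vec ℕ d} {a b} → a ≤ d → b ≤ d → inc a xs ≡ inc b xs → a ≡ b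
inc-injectiveˡ {xs = xs} {zero} _ b≤d eq = sym (sum-inc-injective {xs = xs} b≤d (cong sum (sym eq)))
inc-injectiveˡ {xs = xs} {suc a} {b} a<d _ eq =
  sym (part-inc->⇒≡ {xs = xs} (subst (λ ys → part xs (suc a) < part ys (suc a)) eq
    (≤-reflexive (sym (part-inc-≡ xs a<d)))))

inc-surjective : ∀ {d} {xs : Vec ℕ d} {r} → 0 < part xs (suc r) → ∃ λ ys → inc (suc r) ys ≡ xs
inc-surjective {xs = suc x ∷ xs} {zero} _ = x ∷ xs , refl
inc-surjective {xs = x ∷ xs} {suc r} pos with inc-surjective {xs = xs} {r} pos
... | ys , eq = x ∷ ys , cong (x ∷_) eq

part-∅ : ∀ d i → part (replicate d 0) i ≡ 0
part-∅ zero zero = refl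
part-∅ (suc d) zero = refl
part-∅ zero (suc i) = refl
part-∅ (suc d) (suc zero) = refl
part-∅ (suc d) (suc (suc i)) = part-∅ d (suc i)

sum-∅ : ∀ d → sum (replicate d 0) ≡ 0
sum-∅ zero = refl
sum-∅ (suc d) = sum-∅ d

_⊆_ : ∀ {d} → Vec ℕ d → Vec ℕ d → Set
_⊆_ {d} xs ys = ∀ i → 1 ≤ i → i ≤ d → part xs i ≤ part ys i

⊆-tail : ∀ {d x y} {xs ys : Vec ℕ d} → (x ∷ xs) ⊆ (y ∷ ys) → xs ⊆ ys
⊆-tail xs⊆ys (suc i) _ i≤d = xs⊆ys (suc (suc i)) (s≤s z≤n) (s≤s i≤d)

⊆⇒sum≤ : ∀ {d} {xs ys : Vec ℕ d} → xs ⊆ ys → sum xs ≤ sum ys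
⊆⇒sum≤ {xs = []} {[]} _ = z≤n
⊆⇒sum≤ {xs = x ∷ xs} {y ∷ ys} xs⊆ys = +-mono-≤ (xs⊆ys 1 ≤-refl (s≤s z≤n)) (⊆⇒sum≤ (⊆-tail xs⊆ys))

⊆-sum≡⇒≡ : ∀ {d} {xs ys : Vec ℕ d} → xs ⊆ ys → sum ys ≤ sum xs → xs ≡ ys
⊆-sum≡⇒≡ {xs = []} {[]} _ _ = refl
⊆-sum≡⇒≡ {xs = x ∷ xs} {y ∷ ys} xs⊆ys le with m≤n⇒m<n∨m≡n (xs⊆ys 1 ≤-refl (s≤s z≤n))
... | inj₁ x<y = contradiction (≤-trans (+-mono-<-≤ x<y (⊆⇒sum≤ (⊆-tail xs⊆ys))) le) (<-irrefl refl)
... | inj₂ refl = cong (x ∷_) (⊆-sum≡⇒≡ (⊆-tail xs⊆ys) (+-cancelˡ-≤ x _ _ le))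

⊆-sum-suc⇒inc : ∀ {d} {xs ys : Vec ℕ d} → xs ⊆ ys → sum ys ≡ suc (sum xs) →
  ∃ λ r → suc r ≤ d × inc (suc r) xs ≡ ys
⊆-sum-suc⇒inc {xs = x ∷ xs} {y ∷ ys} xs⊆ys eq with m≤n⇒m<n∨m≡n (xs⊆ys 1 ≤-refl (s≤s z≤n))
... | inj₂ refl with ⊆-sum-suc⇒inc (⊆-tail xs⊆ys) (+-cancelˡ-≡ x _ _ (trans eq (sym (+-suc x (sum xs)))))
...   | r , r<d , inc≡ = suc r , s≤s r<d , cong (x ∷_) inc≡
⊆-sum-suc⇒inc {xs = x ∷ xs} {y ∷ ys} xs⊆ys eq | inj₁ x<y = 0 , s≤s z≤n , cong₂ _∷_ (sym y≡1+x) xs≡ys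
  where
  sum≤ = ⊆⇒sum≤ (⊆-tail xs⊆ys)
  xs≡ys : xs ≡ ys
  xs≡ys = ⊆-sum≡⇒≡ (⊆-tail xs⊆ys) (+-cancelˡ-≤ (suc x) _ _ (≤-trans (+-monoˡ-≤ (sum ys) x<y) (≤-reflexive eq)))
  y≡1+x : y ≡ suc x
  y≡1+x = +-cancelʳ-≡ (sum xs) y (suc x) (trans (cong (λ zs → y + sum zs) xs≡ys) eq)

-- Local rules

-- A unit square of the growth diagram with labels a, b on its bottom and left
-- edges and a′, b′ on its top and right edges; `seed` squares carry the entries
-- of the permutation matrix.
data Cell (d : ℕ) : (a b a′ b′ : ℕ) → Set where
  pass : ∀ {a b} → a ≢ b → Cell d a b a b
  idle : Cell d 0 0 0 0
  seed : Cell d 0 0 1 1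
  bump : ∀ {r} → suc r < d → Cell d (suc r) (suc r) (suc (suc r)) (suc (suc r))
  wrap : ∀ {r} → suc r ≡ d → Cell d (suc r) (suc r) 1 1

module _ {d : ℕ} where

  cell-sym : ∀ {a b a′ b′} → Cell d a b a′ b′ → Cell d b a b′ a′
  cell-sym (pass a≢b) = pass (a≢b ∘ sym)
  cell-sym idle = idle
  cell-sym seed = seed
  cell-sym (bump r<d) = bump r<d
  cell-sym (wrap r≡d) = wrap r≡d

  cell-bounded : ∀ {a b a′ b′} → 1 ≤ d → a ≤ d → Cell d a b a′ b′ → a′ ≤ d
  cell-bounded 1≤d a≤d (pass _) = a≤d
  cell-bounded 1≤d a≤d idle = z≤n
  cell-bounded 1≤d a≤d seed = 1≤d
  cell-bounded 1≤d a≤d (bump r<d) = r<d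
  cell-bounded 1≤d a≤d (wrap _) = 1≤d

  cell-diagonal : ∀ {a b a′ b′} → a ≡ b → Cell d a b a′ b′ → a′ ≡ b′
  cell-diagonal a≡b (pass a≢b) = contradiction a≡b a≢b
  cell-diagonal _ idle = refl
  cell-diagonal _ seed = refl
  cell-diagonal _ (bump _) = refl
  cell-diagonal _ (wrap _) = refl

  cell-nonzero : ∀ {a b a′ b′} → Cell d a b a′ b′ → a ≢ 0 → a′ ≢ 0
  cell-nonzero (pass _) a≢0 = a≢0
  cell-nonzero idle a≢0 = a≢0
  cell-nonzero seed _ ()
  cell-nonzero (bump _) _ ()
  cell-nonzero (wrap _) _ ()

  cell-zero : ∀ {a b a′ b′} → Cell d a b a′ b′ → a′ ≢ 0 → a ≢ 0 ⊎ (a ≡ 0 × b ≡ 0 × a′ ≡ 1)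
  cell-zero (pass _) a≢0 = inj₁ a≢0
  cell-zero idle 0≢0 = inj₁ 0≢0
  cell-zero seed _ = inj₂ (refl , refl , refl)
  cell-zero (bump _) _ = inj₁ λ ()
  cell-zero (wrap _) _ = inj₁ λ ()

  cell-keeps-or-bumps : ∀ {r a b a′ b′} → r < d → Cell d a b a′ b′ → a ≡ r → a′ ≡ r ⊎ (b ≡ r × a′ ≡ suc r)
  cell-keeps-or-bumps _ (pass _) a≡r = inj₁ a≡r
  cell-keeps-or-bumps _ idle a≡r = inj₁ a≡r
  cell-keeps-or-bumps _ seed refl = inj₂ (refl , refl)
  cell-keeps-or-bumps _ (bump _) refl = inj₂ (refl , refl)
  cell-keeps-or-bumps r<d (wrap r≡d) refl = contradiction r≡d (<⇒≢ r<d)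

  cell-source : ∀ {r a b a′ b′} → Cell d a b a′ b′ → a′ ≡ suc r →
    a ≡ suc r ⊎ (a ≡ r × b ≡ r) ⊎ (a ≡ d × b ≡ d)
  cell-source (pass _) a≡1+r = inj₁ a≡1+r
  cell-source seed refl = inj₂ (inj₁ (refl , refl))
  cell-source (bump _) refl = inj₂ (inj₁ (refl , refl))
  cell-source (wrap r≡d) _ = inj₂ (inj₂ (r≡d , r≡d))

  cell-bumps : ∀ {r a b a′ b′} → suc r < d → Cell d a b a′ b′ → a ≡ suc r → b ≡ suc r → a′ ≡ suc (suc r)
  cell-bumps _ (pass a≢b) refl refl = contradiction refl a≢b
  cell-bumps _ (bump _) refl _ = refl
  cell-bumps r<d (wrap r≡d) refl _ = contradiction r≡d (<⇒≢ r<d)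

  cell-deterministic : ∀ {a b a₁ b₁ a₂ b₂} → Cell d a b a₁ b₁ → Cell d a b a₂ b₂ →
    (a ≡ 0 → b ≡ 0 → a₁ ≡ 1 → a₂ ≡ 1) → (a ≡ 0 → b ≡ 0 → a₂ ≡ 1 → a₁ ≡ 1) → a₁ ≡ a₂ × b₁ ≡ b₂
  cell-deterministic (pass _) (pass _) _ _ = refl , refl
  cell-deterministic (pass a≢b) idle _ _ = contradiction refl a≢b
  cell-deterministic (pass a≢b) seed _ _ = contradiction refl a≢b
  cell-deterministic (pass a≢b) (bump _) _ _ = contradiction refl a≢b
  cell-deterministic (pass a≢b) (wrap _) _ _ = contradiction refl a≢b
  cell-deterministic idle (pass a≢b) _ _ = contradiction refl a≢b
  cell-deterministic idle idle _ _ = refl , refl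
  cell-deterministic idle seed _ g with g refl refl refl
  ... | ()
  cell-deterministic seed (pass a≢b) _ _ = contradiction refl a≢b
  cell-deterministic seed idle f _ with f refl refl refl
  ... | ()
  cell-deterministic seed seed _ _ = refl , refl
  cell-deterministic (bump _) (pass a≢b) _ _ = contradiction refl a≢b
  cell-deterministic (bump _) (bump _) _ _ = refl , refl
  cell-deterministic (bump r<d) (wrap r≡d) _ _ = contradiction r≡d (<⇒≢ r<d)
  cell-deterministic (wrap _) (pass a≢b) _ _ = contradiction refl a≢b
  cell-deterministic (wrap r≡d) (bump r<d) _ _ = contradiction r≡d (<⇒≢ r<d)
  cell-deterministic (wrap _) (wrap _) _ _ = refl , refl

  -- Only the squares with a′ = b′ = 1 are ambiguous when read backwards; the hypotheses
  -- tell a seed from a wrap by whether row d is empty at the corner μ.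
  cell-codeterministic : ∀ {a₁ b₁ a₂ b₂ a′ b′} {P : Set} → Cell d a₁ b₁ a′ b′ → Cell d a₂ b₂ a′ b′ →
    (a₁ ≡ 0 → b₁ ≡ 0 → a′ ≡ 1 → P) → (a₂ ≡ 0 → b₂ ≡ 0 → a′ ≡ 1 → P) →
    (a₁ ≡ d → ¬ P) → (a₂ ≡ d → ¬ P) → a₁ ≡ a₂
  cell-codeterministic (pass _) (pass _) _ _ _ _ = refl
  cell-codeterministic (pass a≢b) idle _ _ _ _ = contradiction refl a≢b
  cell-codeterministic (pass a≢b) seed _ _ _ _ = contradiction refl a≢b
  cell-codeterministic (pass a≢b) (bump _) _ _ _ _ = contradiction refl a≢b
  cell-codeterministic (pass a≢b) (wrap _) _ _ _ _ = contradiction refl a≢b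
  cell-codeterministic idle (pass a≢b) _ _ _ _ = contradiction refl a≢b
  cell-codeterministic seed (pass a≢b) _ _ _ _ = contradiction refl a≢b
  cell-codeterministic (bump _) (pass a≢b) _ _ _ _ = contradiction refl a≢b
  cell-codeterministic (wrap _) (pass a≢b) _ _ _ _ = contradiction refl a≢b
  cell-codeterministic idle idle _ _ _ _ = refl
  cell-codeterministic seed seed _ _ _ _ = refl
  cell-codeterministic seed (wrap r≡d) p _ _ ¬p = contradiction (p refl refl refl) (¬p r≡d)
  cell-codeterministic (wrap r≡d) seed _ p ¬p _ = contradiction (p refl refl refl) (¬p r≡d)
  cell-codeterministic (bump _) (bump _) _ _ _ _ = refl
  cell-codeterministic (wrap refl) (wrap refl) _ _ _ _ = refl

-- Cylindric partitions under the local rules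

-- The seam from row `d` back to row 1 is treated as one more adjacency, with offset `L`, so that
-- one argument serves all inequalities. For `d = 1` only the seam is left, and it relates row 1 to
-- itself.
data Adjacent (d L : ℕ) : (k i c : ℕ) → Set where
  below : ∀ {i} → suc i < d → Adjacent d L (suc (suc i)) (suc i) 0
  around : Adjacent d L 1 d L

-- Cylindric partitions: λ₁ ≥ ⋯ ≥ λ_d ≥ λ₁ − L.
Cylindric : (d L : ℕ) → Vec ℕ d → Set
Cylindric d L xs = ∀ {k i c} → Adjacent d L k i c → part xs k ≤ part xs i + c

-- The condition on the lower left corner of a seed; it makes the new box in row 1 legal
-- and separates seeds from wraps.
SeedCorner : ∀ {d} → ℕ → Vec ℕ d → Set
SeedCorner {d} L xs = part xs d ≡ 0 × part xs 1 < L

module _ {e L : ℕ} where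
  private d = suc e

  cylindric-∅ : Cylindric d L (replicate d 0)
  cylindric-∅ {k} {i} {c} _ = subst (_≤ part (replicate d 0) i + c) (sym (part-∅ d k)) z≤n

  -- A new box can violate only an inequality whose smaller side is its own row. As `a` and `b`
  -- differ, each inequality is inherited from one of the two given partitions.
  cylindric-join : ∀ {xs : Vec ℕ d} {a b} → a ≢ b → Cylindric d L (inc a xs) → Cylindric d L (inc b xs) →
    Cylindric d L (inc a (inc b xs))
  cylindric-join {xs} {a} {b} a≢b cμ cν {k} {i} {c} adj with a ≟ k
  ... | no a≢k = begin
    part (inc a (inc b xs)) k     ≡⟨ part-inc-≢ (inc b xs) a≢k ⟩
    part (inc b xs) k             ≤⟨ cν adj ⟩
    part (inc b xs) i + c         ≤⟨ +-monoˡ-≤ c (part-inc-≤ (inc b xs) a i) ⟩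
    part (inc a (inc b xs)) i + c ∎ where open ≤-Reasoning
  ... | yes refl rewrite inc-comm a b xs = begin
    part (inc b (inc a xs)) k     ≡⟨ part-inc-≢ (inc a xs) (a≢b ∘ sym) ⟩
    part (inc a xs) k             ≤⟨ cμ adj ⟩
    part (inc a xs) i + c         ≤⟨ +-monoˡ-≤ c (part-inc-≤ (inc a xs) b i) ⟩
    part (inc b (inc a xs)) i + c ∎ where open ≤-Reasoning

  cylindric-off : ∀ {xs : Vec ℕ d} {a k i c} → a ≢ i → Cylindric d L (inc a xs) → Adjacent d L k i c →
    part xs k ≤ part xs i + c
  cylindric-off {xs} {a} {k} {i} {c} a≢i cμ adj = begin
    part xs k             ≤⟨ part-inc-≤ xs a k ⟩
    part (inc a xs) k     ≤⟨ cμ adj ⟩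
    part (inc a xs) i + c ≡⟨ cong (_+ c) (part-inc-≢ xs a≢i) ⟩
    part xs i + c         ∎ where open ≤-Reasoning

  cylindric-meet : ∀ {xs : Vec ℕ d} {a b} → a ≢ b → Cylindric d L (inc a xs) → Cylindric d L (inc b xs) →
    Cylindric d L xs
  cylindric-meet {xs} {a} {b} a≢b cμ cν {i = i} adj with a ≟ i
  ... | no a≢i = cylindric-off a≢i cμ adj
  ... | yes refl = cylindric-off (a≢b ∘ sym) cν adj

  cylindric-on : ∀ {xs : Vec ℕ d} {a k i c} → a ≢ k → Cylindric d L xs → Adjacent d L k i c →
    part (inc a xs) k ≤ part (inc a xs) i + c
  cylindric-on {xs} {a} {k} {i} {c} a≢k cλ adj = begin
    part (inc a xs) k     ≡⟨ part-inc-≢ xs a≢k ⟩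
    part xs k             ≤⟨ cλ adj ⟩
    part xs i + c         ≤⟨ +-monoˡ-≤ c (part-inc-≤ xs a i) ⟩
    part (inc a xs) i + c ∎ where open ≤-Reasoning

  -- The one inequality at risk bounds row `suc (suc r)` by row `suc r`. It holds for `xs`, and both
  -- of its sides have grown by one. `cylindric-wrap` is the same argument across the seam.
  cylindric-bump : ∀ {xs : Vec ℕ d} {r} → suc r < d → Cylindric d L xs → Cylindric d L (inc (suc r) xs) →
    Cylindric d L (inc (suc (suc r)) (inc (suc r) xs))
  cylindric-bump {xs} {r} r<d cλ cμ {k} {i} {c} adj with suc (suc r) ≟ k
  ... | no a≢k = cylindric-on a≢k cμ adj
  cylindric-bump {xs} {r} r<d cλ cμ (below _) | yes refl = begin
    part (inc (suc (suc r)) μ) (suc (suc r)) ≡⟨ part-inc-≡ μ r<d ⟩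
    suc (part μ (suc (suc r)))               ≡⟨ cong suc (part-inc-≢ xs (<⇒≢ ≤-refl)) ⟩
    suc (part xs (suc (suc r)))              ≤⟨ s≤s (cλ (below r<d)) ⟩
    suc (part xs (suc r) + 0)                ≡⟨ cong (_+ 0) (part-inc-≡ xs (<⇒≤ r<d)) ⟨
    part μ (suc r) + 0                       ≤⟨ +-monoˡ-≤ 0 (part-inc-≤ μ (suc (suc r)) (suc r)) ⟩
    part (inc (suc (suc r)) μ) (suc r) + 0   ∎
    where
    open ≤-Reasoning
    μ = inc (suc r) xs

  cylindric-wrap : ∀ {xs : Vec ℕ d} → Cylindric d L xs → Cylindric d L (inc d xs) →
    Cylindric d L (inc 1 (inc d xs))
  cylindric-wrap {xs} cλ cμ {k} {i} {c} adj with 1 ≟ k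
  ... | no a≢k = cylindric-on a≢k cμ adj
  cylindric-wrap {xs} cλ cμ around | yes refl with 1 ≟ d
  -- For `d = 1` the seam bounds row 1 by itself plus `L`.
  ... | yes 1≡d = ≤-trans (≤-reflexive (cong (part (inc 1 (inc d xs))) 1≡d)) (m≤m+n _ L)
  ... | no 1≢d = begin
    part (inc 1 μ) 1      ≡⟨ part-inc-≡ μ (s≤s z≤n) ⟩
    suc (part μ 1)        ≡⟨ cong suc (part-inc-≢ xs (1≢d ∘ sym)) ⟩
    suc (part xs 1)       ≤⟨ s≤s (cλ around) ⟩
    suc (part xs d) + L   ≡⟨ cong (_+ L) (part-inc-≡ xs ≤-refl) ⟨
    part μ d + L          ≤⟨ +-monoˡ-≤ L (part-inc-≤ μ 1 d) ⟩
    part (inc 1 μ) d + L  ∎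
    where
    open ≤-Reasoning
    μ = inc d xs

  cylindric-seed : ∀ {xs : Vec ℕ d} → Cylindric d L xs → SeedCorner L xs → Cylindric d L (inc 1 xs)
  cylindric-seed {xs} cλ _ {k} adj with 1 ≟ k
  ... | no a≢k = cylindric-on a≢k cλ adj
  cylindric-seed {xs} cλ (_ , λ₁<L) around | yes refl =
    ≤-trans (≤-reflexive (part-inc-≡ xs (s≤s z≤n))) (≤-trans λ₁<L (m≤n+m L _))

  cylindric-cell : ∀ {xs : Vec ℕ d} {a b a′ b′} → Cell d a b a′ b′ →
    (a ≡ 0 → b ≡ 0 → a′ ≡ 1 → SeedCorner L xs) →
    Cylindric d L xs → Cylindric d L (inc a xs) → Cylindric d L (inc b xs) → Cylindric d L (inc a′ (inc b xs))
  cylindric-cell (pass a≢b) _ _ cμ cν = cylindric-join a≢b cμ cν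
  cylindric-cell idle _ cλ _ _ = cλ
  cylindric-cell seed ok cλ _ _ = cylindric-seed cλ (ok refl refl refl)
  cylindric-cell (bump r<d) _ cλ cμ _ = cylindric-bump r<d cλ cμ
  cylindric-cell (wrap refl) _ cλ cμ _ = cylindric-wrap cλ cμ

  -- Inverting a local rule

  -- A lower left corner recovered from the lower right corner `μ`, the upper left corner `ν` and
  -- the top and right labels. Cylindricity is part of the result so that the rule can be iterated,
  -- and `seedCorner` so that the rebuilt diagram satisfies `SeedCorners`.
  record Corner (μ ν : Vec ℕ d) (a′ b′ : ℕ) : Set where
    field
      vertex : Vec ℕ d
      cylindric : Cylindric d L vertex
      a b : ℕ
      a≤d : a ≤ d
      b≤d : b ≤ d
      bottom : inc a vertex ≡ μ
      left : inc b vertex ≡ ν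
      cell : Cell d a b a′ b′
      seedCorner : a ≡ 0 → b ≡ 0 → a′ ≡ 1 → SeedCorner L vertex

  -- For `b` nonzero the upper right corner has a box in row `b`. The step from `ν` adds to another
  -- row, so `ν` has this box already, and removing it gives the vertex.
  corner-pass : ∀ {μ ν : Vec ℕ d} {a b} → a ≢ b → a ≤ d → b ≤ d → inc a ν ≡ inc b μ →
    Cylindric d L μ → Cylindric d L ν → Corner μ ν a b
  corner-pass {b = zero} a≢b a≤d b≤d eq cμ cν = record
    { cylindric = cν ; a≤d = a≤d ; b≤d = z≤n ; bottom = eq ; left = refl ; cell = pass a≢b
    ; seedCorner = λ a≡0 b≡0 _ → contradiction (trans a≡0 (sym b≡0)) a≢b }
  corner-pass {μ} {ν} {a} {suc b} a≢b a≤d b≤d eq cμ cν with inc-surjective {xs = ν} {b} ν-pos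
    where
    ν-pos : 0 < part ν (suc b)
    ν-pos = begin-strict
      0                             <⟨ z<s ⟩
      suc (part μ (suc b))          ≡⟨ part-inc-≡ μ b≤d ⟨
      part (inc (suc b) μ) (suc b)  ≡⟨ cong (λ xs → part xs (suc b)) eq ⟨
      part (inc a ν) (suc b)        ≡⟨ part-inc-≢ ν a≢b ⟩
      part ν (suc b)                ∎ where open ≤-Reasoning
  ... | xs , refl with inc-injectiveʳ (suc b) {inc a xs} {μ} (trans (inc-comm (suc b) a xs) eq)
  ...   | refl = record
    { cylindric = cylindric-meet a≢b cμ cν ; a≤d = a≤d ; b≤d = b≤d ; bottom = refl ; left = refl
    ; cell = pass a≢b ; seedCorner = λ _ () }

  -- Since row `suc (suc r)` can grow, it is strictly shorter than row `suc r` in `μ`. The strict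
  -- inequality both provides a box in row `suc r` and allows its removal.
  corner-bump : ∀ {μ : Vec ℕ d} {r} → suc r < d → Cylindric d L μ → Cylindric d L (inc (suc (suc r)) μ) →
    Corner μ μ (suc (suc r)) (suc (suc r))
  corner-bump {μ} {r} r<d cμ cρ with inc-surjective {xs = μ} {r} (≤-<-trans z≤n μ-descends)
    where
    μ-descends : part μ (suc (suc r)) < part μ (suc r)
    μ-descends = begin
      suc (part μ (suc (suc r)))               ≡⟨ part-inc-≡ μ r<d ⟨
      part (inc (suc (suc r)) μ) (suc (suc r)) ≤⟨ cρ (below r<d) ⟩
      part (inc (suc (suc r)) μ) (suc r) + 0   ≡⟨ +-identityʳ _ ⟩
      part (inc (suc (suc r)) μ) (suc r)       ≡⟨ part-inc-≢ μ {i = suc r} 1+n≢n ⟩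
      part μ (suc r)                           ∎ where open ≤-Reasoning
  ... | xs , refl = record
    { cylindric = cλ ; a≤d = <⇒≤ r<d ; b≤d = <⇒≤ r<d ; bottom = refl ; left = refl
    ; cell = bump r<d ; seedCorner = λ () }
    where
    cλ : Cylindric d L xs
    cλ {i = i} adj with suc r ≟ i
    ... | no a≢i = cylindric-off a≢i cμ adj
    cλ (below _) | yes refl = s≤s⁻¹ (begin
      suc (part xs (suc (suc r)))               ≡⟨ cong suc (part-inc-≢ xs (<⇒≢ ≤-refl)) ⟨
      suc (part μ (suc (suc r)))                ≡⟨ part-inc-≡ μ r<d ⟨
      part (inc (suc (suc r)) μ) (suc (suc r))  ≤⟨ cρ (below r<d) ⟩
      part (inc (suc (suc r)) μ) (suc r) + 0    ≡⟨ cong (_+ 0) (part-inc-≢ μ {i = suc r} 1+n≢n) ⟩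
      part μ (suc r) + 0                        ≡⟨ cong (_+ 0) (part-inc-≡ xs (<⇒≤ r<d)) ⟩
      suc (part xs (suc r) + 0)                 ∎) where open ≤-Reasoning
    cλ around | yes refl = contradiction r<d (<-irrefl refl)

  corner-wrap : ∀ {μ : Vec ℕ d} → 0 < part μ d → Cylindric d L μ → Cylindric d L (inc 1 μ) → Corner μ μ 1 1
  corner-wrap {μ} pos cμ cρ with inc-surjective {xs = μ} {e} pos
  ... | xs , refl = record
    { cylindric = cλ ; a≤d = ≤-refl ; b≤d = ≤-refl ; bottom = refl ; left = refl
    ; cell = wrap refl ; seedCorner = λ () }
    where
    cλ : Cylindric d L xs
    cλ {i = i} adj with d ≟ i
    ... | no d≢i = cylindric-off d≢i cμ adj
    cλ (below i<d) | yes refl = contradiction i<d (<-irrefl refl)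
    cλ around | yes _ with 1 ≟ d
    ... | yes 1≡d = ≤-trans (≤-reflexive (cong (part xs) 1≡d)) (m≤m+n _ L)
    ... | no 1≢d = s≤s⁻¹ (begin
      suc (part xs 1)      ≡⟨ cong suc (part-inc-≢ xs (1≢d ∘ sym)) ⟨
      suc (part μ 1)       ≡⟨ part-inc-≡ μ (s≤s z≤n) ⟨
      part (inc 1 μ) 1     ≤⟨ cρ around ⟩
      part (inc 1 μ) d + L ≡⟨ cong (_+ L) (part-inc-≢ μ 1≢d) ⟩
      part μ d + L         ≡⟨ cong (_+ L) (part-inc-≡ xs ≤-refl) ⟩
      suc (part xs d) + L  ∎) where open ≤-Reasoning

  corner-seed : ∀ {μ : Vec ℕ d} → 1 ≤ L → part μ d ≡ 0 → Cylindric d L μ → Cylindric d L (inc 1 μ) → Corner μ μ 1 1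
  corner-seed {μ} 1≤L μ-last cμ cρ = record
    { cylindric = cμ ; a≤d = z≤n ; b≤d = z≤n ; bottom = refl ; left = refl
    ; cell = seed ; seedCorner = λ _ _ _ → μ-last , μ₁<L }
    where
    μ₁<L : part μ 1 < L
    μ₁<L with 1 ≟ d
    -- For `d = 1` row 1 is the empty row `d`, and the bound becomes `1 ≤ L`.
    ... | yes 1≡d = subst (_< L) (sym (trans (cong (part μ) 1≡d) μ-last)) 1≤L
    ... | no 1≢d = begin
      suc (part μ 1)       ≡⟨ part-inc-≡ μ (s≤s z≤n) ⟨
      part (inc 1 μ) 1     ≤⟨ cρ around ⟩
      part (inc 1 μ) d + L ≡⟨ cong (_+ L) (trans (part-inc-≢ μ 1≢d) μ-last) ⟩
      L                    ∎ where open ≤-Reasoning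

  corner : ∀ {μ ν ρ : Vec ℕ d} {a b} → 1 ≤ L → a ≤ d → b ≤ d → inc a ν ≡ ρ → inc b μ ≡ ρ →
    Cylindric d L μ → Cylindric d L ν → Cylindric d L ρ → Corner μ ν a b
  corner {μ} {ν} {a = a} {b} 1≤L a≤d b≤d refl eq cμ cν cρ with a ≟ b
  ... | no a≢b = corner-pass a≢b a≤d b≤d (sym eq) cμ cν
  ... | yes refl with inc-injectiveʳ a {μ} {ν} eq
  corner {a = zero} _ _ _ refl _ cμ _ _ | yes refl | refl = record
    { cylindric = cμ ; a≤d = z≤n ; b≤d = z≤n ; bottom = refl ; left = refl ; cell = idle ; seedCorner = λ _ _ () }
  corner {a = suc (suc r)} _ a≤d _ refl _ cμ _ cρ | yes refl | refl = corner-bump a≤d cμ cρ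
  -- Label 1 on both edges is the ambiguous case. A wrap has just put a box into row `d` of `μ`, so
  -- an empty row `d` means a seed; otherwise the box can be taken back.
  corner {μ} {a = suc zero} 1≤L _ _ refl _ cμ _ cρ | yes refl | refl with part μ d ≟ 0
  ... | yes μ-last = corner-seed 1≤L μ-last cμ cρ
  ... | no ≢0 = corner-wrap (n≢0⇒n>0 ≢0) cμ cρ

-- Growth diagrams

Point : Set
Point = ℕ × ℕ

-- Vertices are lattice points (i , j) with i counting columns and j rows; h i j labels the edge
-- from (i , j) to (i + 1 , j) and v i j the edge from (i , j) to (i , j + 1).
record Growth (d : ℕ) : Set where
  field
    h v : ℕ → ℕ → ℕ
    Λ : ℕ → ℕ → Vec ℕ d
    h≤d : ∀ i j → h i j ≤ d
    v≤d : ∀ i j → v i j ≤ d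
    right : ∀ i j → Λ (suc i) j ≡ inc (h i j) (Λ i j)
    up : ∀ i j → Λ i (suc j) ≡ inc (v i j) (Λ i j)
    h-bottom : ∀ i → h i 0 ≡ 0
    v-left : ∀ j → v 0 j ≡ 0
    Λ-origin : Λ 0 0 ≡ replicate d 0
    cell : ∀ i j → Cell d (h i j) (v i j) (h i (suc j)) (v (suc i) j)

  -- The right label agrees with the top one by `cell-diagonal`. Level 0 treats a seed as a bump
  -- from row 0 to row 1, which puts the permutation matrix at the bottom of the tower of skeletons.
  Bump : ℕ → Point → Set
  Bump r (i , j) = h i j ≡ r × v i j ≡ r × h i (suc j) ≡ suc r

  Seed : Point → Set
  Seed = Bump 0

transpose : ∀ {d} → Growth d → Growth d
transpose G = record
  { h = λ i j → v j i ; v = λ i j → h j i ; Λ = λ i j → Λ j i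
  ; h≤d = λ i j → v≤d j i ; v≤d = λ i j → h≤d j i
  ; right = λ i j → up j i ; up = λ i j → right j i
  ; h-bottom = v-left ; v-left = h-bottom ; Λ-origin = Λ-origin
  ; cell = λ i j → cell-sym (cell j i) }
  where open Growth G

Bump-transpose : ∀ {d} (G : Growth d) {r i j} → Growth.Bump G r (i , j) → Growth.Bump (transpose G) r (j , i)
Bump-transpose G {i = i} {j} (h≡r , v≡r , h′≡) =
  v≡r , h≡r , trans (sym (cell-diagonal (trans h≡r (sym v≡r)) (cell i j))) h′≡
  where open Growth G

module Columns {d : ℕ} (G : Growth d) where
  open Growth G

  Λ-bottom : ∀ i → Λ i 0 ≡ replicate d 0
  Λ-bottom zero = Λ-origin
  Λ-bottom (suc i) = trans (right i 0) (trans (cong (λ a → inc a (Λ i 0)) (h-bottom i)) (Λ-bottom i))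

  Λ-mono-col : ∀ {i i′} j k → i ≤′ i′ → part (Λ i j) k ≤ part (Λ i′ j) k
  Λ-mono-col j k ≤′-refl = ≤-refl
  Λ-mono-col {i} {suc i′} j k (≤′-step i≤i′) = ≤-trans (Λ-mono-col j k i≤i′)
    (subst (λ xs → part (Λ i′ j) k ≤ part xs k) (sym (right i′ j)) (part-inc-≤ (Λ i′ j) (h i′ j) k))

  Λ-col-label : ∀ {i j r} → r < d → h i j ≡ suc r → part (Λ (suc i) j) (suc r) ≡ suc (part (Λ i j) (suc r))
  Λ-col-label {i} {j} {r} r<d h≡ = begin
    part (Λ (suc i) j) (suc r)           ≡⟨ cong (λ xs → part xs (suc r)) (right i j) ⟩
    part (inc (h i j) (Λ i j)) (suc r)   ≡⟨ cong (λ a → part (inc a (Λ i j)) (suc r)) h≡ ⟩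
    part (inc (suc r) (Λ i j)) (suc r)   ≡⟨ part-inc-≡ (Λ i j) r<d ⟩
    suc (part (Λ i j) (suc r))           ∎ where open ≡-Reasoning

  Λ-col-label⁻¹ : ∀ {i j k} → part (Λ i j) k < part (Λ (suc i) j) k → h i j ≡ k
  Λ-col-label⁻¹ {i} {j} {k} lt = part-inc->⇒≡ {xs = Λ i j} (subst (λ xs → part (Λ i j) k < part xs k) (right i j) lt)

  h-nonzero : ∀ {i j j′} → j ≤′ j′ → h i j ≢ 0 → h i j′ ≢ 0
  h-nonzero ≤′-refl h≢0 = h≢0
  h-nonzero {i} {j′ = suc j′} (≤′-step j≤j′) h≢0 = cell-nonzero (cell i j′) (h-nonzero j≤j′ h≢0)

  -- Every column starts with label 0, and only a seed turns 0 into a nonzero label.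
  seed-below : ∀ {i} j → h i j ≢ 0 → ∃ λ m → m < j × Seed (i , m)
  seed-below {i} zero h≢0 = contradiction (h-bottom i) h≢0
  seed-below {i} (suc j) h≢0 with cell-zero (cell i j) h≢0
  ... | inj₂ s = j , ≤-refl , s
  ... | inj₁ h≢0′ with seed-below j h≢0′
  ...   | m , m<j , s = m , m<n⇒m<1+n m<j , s

  seed⇒nonzero : ∀ {i j j′} → Seed (i , j) → j < j′ → h i j′ ≢ 0
  seed⇒nonzero (_ , _ , h≡1) j<j′ = h-nonzero (≤⇒≤′ j<j′) (λ h≡0 → 0≢1+n (trans (sym h≡0) h≡1))

  seed-unique : ∀ {i j j′} → Seed (i , j) → Seed (i , j′) → j ≡ j′
  seed-unique {i} {j} {j′} s s′ with <-cmp j j′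
  ... | tri< j<j′ _ _ = contradiction (proj₁ s′) (seed⇒nonzero s j<j′)
  ... | tri≈ _ j≡j′ _ = j≡j′
  ... | tri> _ _ j′<j = contradiction (proj₁ s) (seed⇒nonzero s′ j′<j)

  column-stay : ∀ {r i j} → r < d → h i j ≡ r → ∀ {j′} → j ≤′ j′ →
    h i j′ ≡ r ⊎ ∃ λ m → j ≤ m × m < j′ × Bump r (i , m)
  column-stay r<d h≡r ≤′-refl = inj₁ h≡r
  column-stay {i = i} r<d h≡r {suc j′} (≤′-step j≤j′) with column-stay r<d h≡r j≤j′
  ... | inj₂ (m , j≤m , m<j′ , b) = inj₂ (m , j≤m , m<n⇒m<1+n m<j′ , b)
  ... | inj₁ h≡r′ with cell-keeps-or-bumps r<d (cell i j′) h≡r′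
  ...   | inj₁ h≡r″ = inj₁ h≡r″
  ...   | inj₂ (v≡r , h≡1+r) = inj₂ (j′ , ≤′⇒≤ j≤j′ , ≤-refl , h≡r′ , v≡r , h≡1+r)

  -- In such a rectangle the rules are those of the ordinary Robinson-Schensted growth diagram.
  NoWrap : ℕ → ℕ → Set
  NoWrap I J = ∀ {i j} → i < I → j < J → h i j ≡ d → v i j ≡ d → ⊥

  column-source : ∀ {I J r i} → NoWrap I J → i < I → ∀ j → j ≤ J → h i j ≡ suc r →
    ∃ λ y → y < j × Bump r (i , y) × (∀ {m} → y < m → m ≤ j → h i m ≡ suc r)
  column-source {i = i} nw i<I zero _ h≡ = contradiction (trans (sym (h-bottom i)) h≡) 0≢1+n
  column-source {r = r} {i} nw i<I (suc j) j<J h≡ with cell-source (cell i j) h≡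
  ... | inj₂ (inj₁ (h≡r , v≡r)) = j , ≤-refl , (h≡r , v≡r , h≡) ,
    λ j<m m≤1+j → trans (cong (h i) (≤-antisym m≤1+j j<m)) h≡
  ... | inj₂ (inj₂ (h≡d , v≡d)) = contradiction v≡d (nw i<I j<J h≡d)
  ... | inj₁ h≡′ with column-source nw i<I j (<⇒≤ j<J) h≡′
  ...   | y , y<j , b , between = y , m<n⇒m<1+n y<j , b , between′
    where
    between′ : ∀ {m} → y < m → m ≤ suc j → h i m ≡ suc r
    between′ y<m m≤1+j with m≤n⇒m<n∨m≡n m≤1+j
    ... | inj₁ m≤j = between y<m (s≤s⁻¹ m≤j)
    ... | inj₂ refl = h≡

open Columns

NoWrap-transpose : ∀ {d} (G : Growth d) {I J} → NoWrap G I J → NoWrap (transpose G) J I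
NoWrap-transpose G nw j<J i<I v≡d h≡d = nw i<I j<J h≡d v≡d

Λ-mono : ∀ {d} (G : Growth d) {i i′ j j′} k → i ≤ i′ → j ≤ j′ →
  part (Growth.Λ G i j) k ≤ part (Growth.Λ G i′ j′) k
Λ-mono G k i≤i′ j≤j′ =
  ≤-trans (Λ-mono-col G _ k (≤⇒≤′ i≤i′)) (Λ-mono-col (transpose G) _ k (≤⇒≤′ j≤j′))

-- Rigidity: seeds or boundary determine the diagram

module _ {d : ℕ} (G₁ G₂ : Growth d) where
  private
    module G₁ = Growth G₁
    module G₂ = Growth G₂

  -- Read upwards and rightwards, the rules leave a single choice, between idle and seed on squares
  -- with labels 0 and 0; the set of seeds settles it.
  labels-unique : (∀ {p} → G₁.Seed p → G₂.Seed p) → (∀ {p} → G₂.Seed p → G₁.Seed p) →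
    ∀ i j → G₁.h i j ≡ G₂.h i j × G₁.v i j ≡ G₂.v i j
  labels-unique s₁⇒s₂ s₂⇒s₁ = λ i j → h≡ i j , v≡ i j
    where
    cells≡ : ∀ i j → G₁.h i j ≡ G₂.h i j → G₁.v i j ≡ G₂.v i j →
      G₁.h i (suc j) ≡ G₂.h i (suc j) × G₁.v (suc i) j ≡ G₂.v (suc i) j
    cells≡ i j hij vij = cell-deterministic
      (subst₂ (λ a b → Cell d a b (G₁.h i (suc j)) (G₁.v (suc i) j)) hij vij (G₁.cell i j)) (G₂.cell i j)
      (λ a≡0 b≡0 a′≡1 → proj₂ (proj₂ (s₁⇒s₂ (trans hij a≡0 , trans vij b≡0 , a′≡1))))
      (λ a≡0 b≡0 a′≡1 → proj₂ (proj₂ (s₂⇒s₁ (a≡0 , b≡0 , a′≡1))))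
    h≡ : ∀ i j → G₁.h i j ≡ G₂.h i j
    v≡ : ∀ i j → G₁.v i j ≡ G₂.v i j
    h≡ i zero = trans (G₁.h-bottom i) (sym (G₂.h-bottom i))
    h≡ i (suc j) = proj₁ (cells≡ i j (h≡ i j) (v≡ i j))
    v≡ zero j = trans (G₁.v-left j) (sym (G₂.v-left j))
    v≡ (suc i) j = proj₂ (cells≡ i j (h≡ i j) (v≡ i j))

  Λ-unique : (∀ {p} → G₁.Seed p → G₂.Seed p) → (∀ {p} → G₂.Seed p → G₁.Seed p) →
    ∀ i j → G₁.Λ i j ≡ G₂.Λ i j
  Λ-unique s₁⇒s₂ s₂⇒s₁ zero j = trans (Λ-bottom (transpose G₁) j) (sym (Λ-bottom (transpose G₂) j))
  Λ-unique s₁⇒s₂ s₂⇒s₁ (suc i) j = trans (G₁.right i j)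
    (trans (cong₂ inc (proj₁ (labels-unique s₁⇒s₂ s₂⇒s₁ i j)) (Λ-unique s₁⇒s₂ s₂⇒s₁ i j)) (sym (G₂.right i j)))

  Λ≡⇒h≡ : ∀ {i j} → G₁.Λ i j ≡ G₂.Λ i j → G₁.Λ (suc i) j ≡ G₂.Λ (suc i) j → G₁.h i j ≡ G₂.h i j
  Λ≡⇒h≡ {i} {j} Λ≡ Λ′≡ = inc-injectiveˡ {xs = G₁.Λ i j} (G₁.h≤d i j) (G₂.h≤d i j)
    (trans (sym (G₁.right i j)) (trans Λ′≡ (trans (G₂.right i j) (cong (inc (G₂.h i j)) (sym Λ≡)))))

SeedCorners : ∀ {d} → ℕ → Growth d → Set
SeedCorners L G = ∀ {i j} → Growth.Seed G (i , j) → SeedCorner L (Growth.Λ G i j)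

SeedCorners-transpose : ∀ {d L} (G : Growth d) → SeedCorners L G → SeedCorners L (transpose G)
SeedCorners-transpose G ok s = ok (Bump-transpose (transpose G) s)

module _ {e L : ℕ} (G : Growth (suc e)) (ok : SeedCorners L G) where
  open Growth G

  Λ-cylindric : ∀ i j → Cylindric (suc e) L (Λ i j)
  Λ-cylindric zero j = subst (Cylindric (suc e) L) (sym (Λ-bottom (transpose G) j)) cylindric-∅
  Λ-cylindric (suc i) zero = subst (Cylindric (suc e) L) (sym (Λ-bottom G (suc i))) cylindric-∅
  Λ-cylindric (suc i) (suc j) =
    subst (Cylindric (suc e) L) (sym (trans (right i (suc j)) (cong (inc (h i (suc j))) (up i j))))
      (cylindric-cell (cell i j) (λ a b c → ok (a , b , c)) (Λ-cylindric i j)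
        (subst (Cylindric (suc e) L) (right i j) (Λ-cylindric (suc i) j))
        (subst (Cylindric (suc e) L) (up i j) (Λ-cylindric i (suc j))))

module _ {e L n : ℕ} (G₁ G₂ : Growth (suc e)) (ok₁ : SeedCorners L G₁) (ok₂ : SeedCorners L G₂) where
  private
    d = suc e
    module G₁ = Growth G₁
    module G₂ = Growth G₂

  -- Induction on the distances `i′` and `j′` to the boundary. Three known corners fix the top and
  -- right labels, and the backward rule then fixes the bottom label and with it the fourth corner.
  boundary-determines-Λ : (∀ {i} → i ≤ n → G₁.Λ i n ≡ G₂.Λ i n) → (∀ {j} → j ≤ n → G₁.Λ n j ≡ G₂.Λ n j) →
    ∀ i′ j′ {i j} → i′ + i ≡ n → j′ + j ≡ n → G₁.Λ i j ≡ G₂.Λ i j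
  boundary-determines-Λ top side zero j′ {j = j} refl j≡ = side (subst (j ≤_) j≡ (m≤n+m j j′))
  boundary-determines-Λ top side (suc i′) zero {i} i≡ refl = top (subst (i ≤_) i≡ (m≤n+m i (suc i′)))
  boundary-determines-Λ top side (suc i′) (suc j′) {i} {j} i≡ j≡ = inc-injectiveʳ (G₂.h i j) (begin
      inc (G₂.h i j) (G₁.Λ i j)  ≡⟨ cong (λ a → inc a (G₁.Λ i j)) h≡ ⟨
      inc (G₁.h i j) (G₁.Λ i j)  ≡⟨ G₁.right i j ⟨
      G₁.Λ (suc i) j             ≡⟨ μ≡ ⟩
      G₂.Λ (suc i) j             ≡⟨ G₂.right i j ⟩
      inc (G₂.h i j) (G₂.Λ i j)  ∎)
    where
    open ≡-Reasoning
    recur = boundary-determines-Λ top side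
    ρ≡ = recur i′ j′ (trans (+-suc i′ i) i≡) (trans (+-suc j′ j) j≡)
    μ≡ = recur i′ (suc j′) (trans (+-suc i′ i) i≡) j≡
    ν≡ = recur (suc i′) j′ i≡ (trans (+-suc j′ j) j≡)
    a′≡ = Λ≡⇒h≡ G₁ G₂ ν≡ ρ≡
    b′≡ = Λ≡⇒h≡ (transpose G₁) (transpose G₂) μ≡ ρ≡
    seed⇒μ-last : ∀ (G : Growth d) → SeedCorners L G → let open Growth G in
      h i j ≡ 0 → v i j ≡ 0 → h i (suc j) ≡ 1 → part (Λ (suc i) j) d ≡ 0
    seed⇒μ-last G ok h≡ v≡ h′≡ = trans (cong (λ xs → part xs d) (trans (right i j) (cong (λ a → inc a (Λ i j)) h≡)))
      (proj₁ (ok (h≡ , v≡ , h′≡)))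
      where open Growth G
    wrap⇒μ-last : ∀ (G : Growth d) → let open Growth G in h i j ≡ d → part (Λ (suc i) j) d ≢ 0
    wrap⇒μ-last G h≡ eq = 0≢1+n (trans (sym eq) (Λ-col-label G ≤-refl h≡))
    h≡ : G₁.h i j ≡ G₂.h i j
    -- At a seed the bottom label is 0, so `μ` equals λ and its row `d` is empty; a wrap has just
    -- added a box there. This is a property of `μ`, which both diagrams share.
    h≡ = cell-codeterministic {P = part (G₁.Λ (suc i) j) d ≡ 0} (G₁.cell i j)
      (subst₂ (Cell d (G₂.h i j) (G₂.v i j)) (sym a′≡) (sym b′≡) (G₂.cell i j))
      (seed⇒μ-last G₁ ok₁)
      (λ h≡ v≡ h′≡ → trans (cong (λ xs → part xs d) μ≡) (seed⇒μ-last G₂ ok₂ h≡ v≡ (trans (sym a′≡) h′≡)))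
      (wrap⇒μ-last G₁)
      (λ h≡ eq → wrap⇒μ-last G₂ h≡ (trans (cong (λ xs → part xs d) (sym μ≡)) eq))

-- Schensted's theorem

_↗_ _↘_ : Point → Point → Set
(a , b) ↗ (i , j) = a < i × b < j
(a , b) ↘ (i , j) = a < i × j < b

-- The number counts steps, so a chain has one point more; the point in the index is the last one.
data Chain (X : Point → Set) (R : Point → Point → Set) : ℕ → Point → Set where
  [_]    : ∀ {p} → X p → Chain X R 0 p
  _▷⟨_⟩_ : ∀ {k p q} → Chain X R k p → R p q → X q → Chain X R (suc k) q

Chain-map : ∀ {X Y R k p} → (∀ {q} → X q → Y q) → Chain X R k p → Chain Y R k p
Chain-map f [ x ] = [ f x ]
Chain-map f (c ▷⟨ r ⟩ x) = Chain-map f c ▷⟨ r ⟩ f x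

Chain-length : ∀ {X R k l p} → k ≡ l → Chain X R k p → Chain X R l p
Chain-length refl c = c

Chain-last : ∀ {X R k p} → Chain X R k p → X p
Chain-last [ x ] = x
Chain-last (_ ▷⟨ _ ⟩ x) = x

Box : ℕ → ℕ → (Point → Set) → Point → Set
Box I J X p = proj₁ p < I × proj₂ p < J × X p

Box-mono : ∀ {I J I′ J′ X p} → I ≤ I′ → J ≤ J′ → Box I J X p → Box I′ J′ X p
Box-mono I≤ J≤ (i<I , j<J , x) = ≤-trans i<I I≤ , ≤-trans j<J J≤ , x

module _ {e : ℕ} (G : Growth (suc e)) where
  open Growth G
  private d = suc e

  -- Bumps at level r are the points of the r-th iterated skeleton of the permutation;
  -- the longest decreasing chain gets shorter by exactly one from each level to the next.
  bump-between : ∀ {r a b a₀ b₀} → suc r < d → Bump r (a₀ , b₀) → Bump r (a , b) → a₀ < a → b < b₀ →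
    ∃ λ p → Bump (suc r) p × a₀ < proj₁ p × proj₁ p ≤ a × b < proj₂ p × proj₂ p ≤ b₀
  -- Column `a` leaves the lower bump upwards and row `b₀` leaves the upper bump rightwards, both
  -- with label `suc r`. Either one bumps on its way, or they meet and bump at `(a , b₀)`.
  bump-between {r} {a} {b} {a₀} {b₀} r<d B₀ B a₀<a b<b₀
    with column-stay G r<d (proj₂ (proj₂ B)) (≤⇒≤′ b<b₀)
       | column-stay (transpose G) r<d (proj₂ (proj₂ (Bump-transpose G B₀))) (≤⇒≤′ a₀<a)
  ... | inj₂ (m , b<m , m<b₀ , B′) | _ = (a , m) , B′ , a₀<a , ≤-refl , b<m , <⇒≤ m<b₀
  ... | _ | inj₂ (m , a₀<m , m<a , B′) = (m , b₀) , Bump-transpose (transpose G) B′ , a₀<m , <⇒≤ m<a , b<b₀ , ≤-refl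
  ... | inj₁ h≡ | inj₁ v≡ = (a , b₀) , (h≡ , v≡ , cell-bumps r<d (cell a b₀) h≡ v≡) , a₀<a , ≤-refl , b<b₀ , ≤-refl

  -- One point is taken between each two neighbours, which costs one step. The half-open bounds of
  -- `bump-between` make consecutive choices strictly decreasing again.
  chain-raise : ∀ {I J r k a b} → suc r < d → Chain (Box I J (Bump r)) _↘_ (suc k) (a , b) →
    ∃ λ q → Chain (Box I J (Bump (suc r))) _↘_ k q × proj₁ q ≤ a × b < proj₂ q
  chain-raise {k = k} r<d (c ▷⟨ a₀<a , b<b₀ ⟩ (a<I , _ , B)) with Chain-last c
  ... | _ , b₀<J , B₀ with bump-between r<d B₀ B a₀<a b<b₀
  ...   | q , B′ , a₀<q , q≤a , b<q , q≤b₀ = q , extend c , q≤a , b<q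
    where
    boxed = ≤-<-trans q≤a a<I , ≤-<-trans q≤b₀ b₀<J , B′
    extend : ∀ {k} → Chain _ _↘_ k _ → Chain _ _↘_ k q
    extend [ _ ] = [ boxed ]
    extend c@(_ ▷⟨ _ ⟩ _) with chain-raise r<d c
    ... | q₀ , c′ , q₀≤a₀ , b₀<q₀ = c′ ▷⟨ ≤-<-trans q₀≤a₀ a₀<q , ≤-<-trans q≤b₀ b₀<q₀ ⟩ boxed

  module _ {I J : ℕ} (nw : NoWrap G I J) where

    bump-source-below : ∀ {r i j} → Box I J (Bump (suc r)) (i , j) →
      ∃ λ y → y < j × Bump r (i , y) × (∀ {m} → y < m → m ≤ j → h i m ≡ suc r)
    bump-source-below (i<I , j<J , h≡ , _) = column-source G nw i<I _ (<⇒≤ j<J) h≡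

    bump-source-left : ∀ {r i j} → Box I J (Bump (suc r)) (i , j) →
      ∃ λ x → x < i × Bump r (x , j) × (∀ {m} → x < m → m ≤ i → v m j ≡ suc r)
    bump-source-left (i<I , j<J , _ , v≡ , _)
      with column-source (transpose G) (NoWrap-transpose G nw) j<J _ (<⇒≤ i<I) v≡
    ... | x , x<i , B , between = x , x<i , Bump-transpose (transpose G) B , between

    -- If both sources fell outside the rectangle, row j and column i₀ would cross at (i₀ , j) with
    -- equal labels and bump there, so that column i₀ could not reach (i₀ , j₀) unchanged.
    source-between : ∀ {r i j i₀ j₀} → suc r < d → Box I J (Bump (suc r)) (i₀ , j₀) → Box I J (Bump (suc r)) (i , j) →
      i₀ < i → j < j₀ → ∃ λ p → Box I J (Bump r) p × i₀ ≤ proj₁ p × proj₁ p < i × j ≤ proj₂ p × proj₂ p < j₀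
    source-between {r} {i} {j} {i₀} {j₀} r<d B₀ B i₀<i j<j₀ with bump-source-below B₀ | bump-source-left B
    ... | y , y<j₀ , By , between-y | x , x<i , Bx , between-x with j ≤? y | i₀ ≤? x
    ... | yes j≤y | _ = (i₀ , y) , (proj₁ B₀ , <-trans y<j₀ (proj₁ (proj₂ B₀)) , By) , ≤-refl , i₀<i , j≤y , y<j₀
    ... | _ | yes i₀≤x = (x , j) , (<-trans x<i (proj₁ B) , proj₁ (proj₂ B) , Bx) , i₀≤x , x<i , ≤-refl , j<j₀
    ... | no j≰y | no i₀≰x = contradiction (trans (sym bumped) (between-y (m<n⇒m<1+n y<j) j<j₀)) 1+n≢n
      where
      y<j = ≰⇒> j≰y
      bumped : h i₀ (suc j) ≡ suc (suc r)
      bumped = cell-bumps r<d (cell i₀ j) (between-y y<j (<⇒≤ j<j₀)) (between-x (≰⇒> i₀≰x) (<⇒≤ i₀<i))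

    -- The new chain consists of the left source of the first bump and one source between each two
    -- neighbours, hence has the same length. The bounds on its last point leave room for one more.
    chain-lower′ : ∀ {r k i j} → suc r < d → Chain (Box I J (Bump (suc r))) _↘_ k (i , j) →
      ∃ λ p → Chain (Box I J (Bump r)) _↘_ k p × proj₁ p < i × j ≤ proj₂ p
    chain-lower′ r<d [ B ] with bump-source-left B
    ... | x , x<i , Bx , _ = (x , _) , [ <-trans x<i (proj₁ B) , proj₁ (proj₂ B) , Bx ] , x<i , ≤-refl
    chain-lower′ r<d (c ▷⟨ i₀<i , j<j₀ ⟩ B) with chain-lower′ r<d c | source-between r<d (Chain-last c) B i₀<i j<j₀
    ... | p₀ , c′ , p₀<i₀ , j₀≤p₀ | p , Bp , i₀≤p , p<i , j≤p , p<j₀ =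
      p , c′ ▷⟨ <-≤-trans p₀<i₀ i₀≤p , <-≤-trans p<j₀ j₀≤p₀ ⟩ Bp , p<i , j≤p

    -- The additional point is the source below the last bump.
    chain-lower : ∀ {r k q} → suc r < d → Chain (Box I J (Bump (suc r))) _↘_ k q →
      ∃ λ p → Chain (Box I J (Bump r)) _↘_ (suc k) p
    chain-lower r<d c with chain-lower′ r<d c | Chain-last c
    ... | p , c′ , p<i , j≤p | B@(i<I , j<J , _) with bump-source-below B
    ...   | y , y<j , By , _ = _ , c′ ▷⟨ p<i , <-≤-trans y<j j≤p ⟩ (i<I , <-trans y<j j<J , By)

    chain-lower* : ∀ r {k q} → r < d → Chain (Box I J (Bump r)) _↘_ k q →
      ∃ λ p → Chain (Box I J Seed) _↘_ (r + k) p
    chain-lower* zero _ c = _ , c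
    chain-lower* (suc r) {k} r<d c with chain-lower* r (<⇒≤ r<d) (proj₂ (chain-lower r<d c))
    ... | p , c′ = p , Chain-length (+-suc r k) c′

  chain-raise* : ∀ {I J} r {k p} → r < d → Chain (Box I J Seed) _↘_ (r + k) p →
    ∃ λ q → Chain (Box I J (Bump r)) _↘_ k q
  chain-raise* zero _ c = _ , c
  chain-raise* (suc r) {k} {p} r<d c
    with chain-raise* r (<⇒≤ r<d) (Chain-length (sym (+-suc r k)) c)
  ... | _ , c′ with chain-raise r<d c′
  ...   | q , c″ , _ = q , c″

  Λ-last≡0⇒NoWrap : ∀ {I J} → part (Λ I J) d ≡ 0 → NoWrap G I J
  Λ-last≡0⇒NoWrap {I} {J} last≡0 {i} {j} i<I j<J h≡d _ = contradiction (begin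
    suc (part (Λ i j) d)  ≡⟨ Λ-col-label G ≤-refl h≡d ⟨
    part (Λ (suc i) j) d  ≤⟨ Λ-mono G d i<I (<⇒≤ j<J) ⟩
    part (Λ I J) d        ≡⟨ last≡0 ⟩
    0                     ∎) λ () where open ≤-Reasoning

  Λ-zero-col : ∀ j k → part (Λ 0 j) k ≡ 0
  Λ-zero-col j k = trans (cong (λ xs → part xs k) (Λ-bottom (transpose G) j)) (part-∅ d k)

  Λ-zero-row : ∀ i k → part (Λ i 0) k ≡ 0
  Λ-zero-row i k = trans (cong (λ xs → part xs k) (Λ-bottom G i)) (part-∅ d k)

  -- Retreat left or down while row `d` stays nonempty. In the square where this stops, row `d`
  -- receives its first box, which must come from a bump out of row `e`. The empty row `d` at the
  -- lower right corner is recorded to exclude wraps up to and including this square.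
  first-last-bump : ∀ I J → 0 < part (Λ I J) d → ∃ λ p → Box I J (Bump e) p ×
    part (Λ (suc (proj₁ p)) (proj₂ p)) d ≡ 0
  first-last-bump zero J pos = contradiction (sym (Λ-zero-col J d)) (<⇒≢ pos)
  first-last-bump (suc I) zero pos = contradiction (sym (Λ-zero-row (suc I) d)) (<⇒≢ pos)
  first-last-bump (suc I) (suc J) pos with part (Λ (suc I) J) d ≟ 0 | part (Λ I (suc J)) d ≟ 0
  ... | no ≢0 | _ with first-last-bump (suc I) J (n≢0⇒n>0 ≢0)
  ...   | p , B , last≡0 = p , Box-mono {X = Bump e} ≤-refl (n≤1+n J) B , last≡0
  first-last-bump (suc I) (suc J) pos | _ | no ≢0 with first-last-bump I (suc J) (n≢0⇒n>0 ≢0)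
  ...   | p , B , last≡0 = p , Box-mono {X = Bump e} (n≤1+n I) ≤-refl B , last≡0
  first-last-bump (suc I) (suc J) pos | yes μ≡0 | yes ν≡0 = (I , J) , (≤-refl , ≤-refl , bump-here) , μ≡0
    where
    h′≡d : h I (suc J) ≡ d
    h′≡d = Λ-col-label⁻¹ G (subst (_< part (Λ (suc I) (suc J)) d) (sym ν≡0) pos)
    h≢d : h I J ≢ d
    h≢d h≡d = contradiction (trans (sym μ≡0) (Λ-col-label G ≤-refl h≡d)) 0≢1+n
    bump-here : Bump e (I , J)
    bump-here with cell-source (cell I J) h′≡d
    ... | inj₁ h≡d = contradiction h≡d h≢d
    ... | inj₂ (inj₁ (h≡e , v≡e)) = h≡e , v≡e , h′≡d
    ... | inj₂ (inj₂ (h≡d , _)) = contradiction h≡d h≢d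

  Λ-last>0⇒chain : ∀ {I J} → 0 < part (Λ I J) d → ∃ λ p → Chain (Box I J Seed) _↘_ e p
  Λ-last>0⇒chain {I} {J} pos with first-last-bump I J pos
  ... | (i , j) , (i<I , j<J , B) , last≡0
    with chain-lower* nw e ≤-refl [ ≤-refl , ≤-refl , B ]
    where
    -- A wrap shows a box in row `d` already at its lower right corner, and for all squares
    -- concerned this corner lies weakly to the lower left of `(suc i , j)`.
    nw : NoWrap G (suc i) (suc j)
    nw {i₀} {j₀} i₀≤i j₀≤j h≡d _ = contradiction (begin
      suc (part (Λ i₀ j₀) d)  ≡⟨ Λ-col-label G ≤-refl h≡d ⟨
      part (Λ (suc i₀) j₀) d  ≤⟨ Λ-mono G d i₀≤i (s≤s⁻¹ j₀≤j) ⟩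
      part (Λ (suc i) j) d    ≡⟨ last≡0 ⟩
      0                       ∎) λ () where open ≤-Reasoning
  ... | p , c = p , Chain-map (Box-mono {X = Seed} i<I j<J) (Chain-length (+-identityʳ e) c)

  chain⇒Λ-last>0 : ∀ {I J p} → Chain (Box I J Seed) _↘_ e p → 0 < part (Λ I J) d
  chain⇒Λ-last>0 {I} {J} {p} c
    with chain-raise* e ≤-refl (Chain-length (sym (+-identityʳ e)) c)
  ... | (i , j) , c′ with Chain-last c′
  ...   | i<I , j<J , _ , _ , h≡d = begin
    1                                ≤⟨ s≤s z≤n ⟩
    suc (part (Λ i (suc j)) d)       ≡⟨ Λ-col-label G ≤-refl h≡d ⟨
    part (Λ (suc i) (suc j)) d       ≤⟨ Λ-mono G d i<I j<J ⟩
    part (Λ I J) d                   ∎ where open ≤-Reasoning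

  chain⇒Λ-first : ∀ {k i j} → Chain Seed _↗_ k (i , j) → k < part (Λ (suc i) (suc j)) 1
  chain⇒Λ-first {k} {i} {j} c with Chain-last c
  ... | _ , _ , h≡1 = begin
    suc k                            ≤⟨ s≤s (shorter c) ⟩
    suc (part (Λ i j) 1)             ≤⟨ s≤s (Λ-mono G 1 ≤-refl (n≤1+n j)) ⟩
    suc (part (Λ i (suc j)) 1)       ≡⟨ Λ-col-label G z<s h≡1 ⟨
    part (Λ (suc i) (suc j)) 1       ∎
    where
    open ≤-Reasoning
    shorter : ∀ {k} → Chain Seed _↗_ k (i , j) → k ≤ part (Λ i j) 1
    shorter [ _ ] = z≤n
    shorter (c₀ ▷⟨ i₀<i , j₀<j ⟩ _) = ≤-trans (chain⇒Λ-first c₀) (Λ-mono G 1 i₀<i j₀<j)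

  -- Retreat while λ₁ still exceeds `k`. Where this stops, the last step on either side is in row 1,
  -- which without wraps only a seed can cause. The rest of the chain comes from the lower left
  -- corner, whose row 1 is shorter by exactly one.
  Λ-first⇒chain : ∀ I J {k} → NoWrap G I J → k < part (Λ I J) 1 → ∃ λ p → p ↗ (I , J) × Chain Seed _↗_ k p
  Λ-first⇒chain zero J _ k<λ₁ = contradiction k<λ₁ (subst (λ m → _ ≮ m) (sym (Λ-zero-col J 1)) λ ())
  Λ-first⇒chain (suc I) zero _ k<λ₁ = contradiction k<λ₁ (subst (λ m → _ ≮ m) (sym (Λ-zero-row (suc I) 1)) λ ())
  Λ-first⇒chain (suc I) (suc J) {k} nw k<λ₁ with k <? part (Λ (suc I) J) 1 | k <? part (Λ I (suc J)) 1
  ... | yes k<μ₁ | _ with Λ-first⇒chain (suc I) J (λ i< j< → nw i< (m<n⇒m<1+n j<)) k<μ₁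
  ...   | p , (i< , j<) , c = p , (i< , m<n⇒m<1+n j<) , c
  Λ-first⇒chain (suc I) (suc J) {k} nw k<λ₁ | no _ | yes k<ν₁
    with Λ-first⇒chain I (suc J) (λ i< j< → nw (m<n⇒m<1+n i<) j<) k<ν₁
  ...   | p , (i< , j<) , c = p , (m<n⇒m<1+n i< , j<) , c
  Λ-first⇒chain (suc I) (suc J) {k} nw k<λ₁ | no k≮μ₁ | no k≮ν₁ = (I , J) , (≤-refl , ≤-refl) , chain k k≤Λ
    where
    h′≡1 : h I (suc J) ≡ 1
    h′≡1 = Λ-col-label⁻¹ G (≤-<-trans (≮⇒≥ k≮ν₁) k<λ₁)
    v′≡1 : v (suc I) J ≡ 1
    v′≡1 = Λ-col-label⁻¹ (transpose G) (≤-<-trans (≮⇒≥ k≮μ₁) k<λ₁)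
    seed-here : Seed (I , J)
    seed-here with cell-source (cell I J) h′≡1 | cell-source (cell-sym (cell I J)) v′≡1
    ... | inj₂ (inj₁ (h≡0 , v≡0)) | _ = h≡0 , v≡0 , h′≡1
    ... | inj₂ (inj₂ (h≡d , v≡d)) | _ = contradiction v≡d (nw ≤-refl ≤-refl h≡d)
    ... | _ | inj₂ (inj₁ (v≡0 , h≡0)) = h≡0 , v≡0 , h′≡1
    ... | _ | inj₂ (inj₂ (v≡d , h≡d)) = contradiction v≡d (nw ≤-refl ≤-refl h≡d)
    -- Equal labels 1 bump to row 2, or wrap if `d = 1`.
    ... | inj₁ h≡1 | inj₁ v≡1 with m≤n⇒m<n∨m≡n {1} {d} z<s
    ...   | inj₁ 1<d = contradiction (trans (sym (cell-bumps 1<d (cell I J) h≡1 v≡1)) h′≡1) 1+n≢n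
    ...   | inj₂ 1≡d = contradiction (trans v≡1 1≡d) (nw ≤-refl ≤-refl (trans h≡1 1≡d))
    k≤Λ : k ≤ part (Λ I J) 1
    k≤Λ = s≤s⁻¹ (begin
      suc k                              ≤⟨ k<λ₁ ⟩
      part (Λ (suc I) (suc J)) 1         ≡⟨ Λ-col-label G z<s h′≡1 ⟩
      suc (part (Λ I (suc J)) 1)         ≡⟨ cong (λ xs → suc (part xs 1)) (up I J) ⟩
      suc (part (inc (v I J) (Λ I J)) 1) ≡⟨ cong (λ b → suc (part (inc b (Λ I J)) 1)) (proj₁ (proj₂ seed-here)) ⟩
      suc (part (Λ I J) 1)               ∎) where open ≤-Reasoning
    chain : ∀ k → k ≤ part (Λ I J) 1 → Chain Seed _↗_ k (I , J)
    chain zero _ = [ seed-here ]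
    chain (suc k) k<λ₁ with Λ-first⇒chain I J (λ i< j< → nw (m<n⇒m<1+n i<) (m<n⇒m<1+n j<)) k<λ₁
    ... | p , p↗ , c = c ▷⟨ p↗ ⟩ seed-here

-- Pattern avoidance

snoc : ∀ {A : Set} {k} → (Fin k → A) → A → Fin (suc k) → A
snoc {k = zero} f x _ = x
snoc {k = suc k} f x Fin.zero = f Fin.zero
snoc {k = suc k} f x (Fin.suc a) = snoc (f ∘ Fin.suc) x a

snoc-fromℕ : ∀ {A : Set} {k} (f : Fin k → A) x → snoc f x (fromℕ k) ≡ x
snoc-fromℕ {k = zero} f x = refl
snoc-fromℕ {k = suc k} f x = snoc-fromℕ (f ∘ Fin.suc) x

snoc-inject₁ : ∀ {A : Set} {k} (f : Fin k → A) x a → snoc f x (inject₁ a) ≡ f a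
snoc-inject₁ f x Fin.zero = refl
snoc-inject₁ f x (Fin.suc a) = snoc-inject₁ (f ∘ Fin.suc) x a

snoc-pairs : ∀ {A : Set} {k} (R : A → A → Set) (f : Fin k → A) x →
  (∀ a b → a <ᶠ b → R (f a) (f b)) → ∀ a b → a <ᶠ b → toℕ b < k → R (snoc f x a) (snoc f x b)
snoc-pairs {k = k} R f x inner a b a<b b<k with view a | view b
... | ‵inject₁ a′ | ‵inject₁ b′ = subst₂ R (sym (snoc-inject₁ f x a′)) (sym (snoc-inject₁ f x b′))
  (inner a′ b′ (subst₂ _<_ (toℕ-inject₁ a′) (toℕ-inject₁ b′) a<b))
... | _ | ‵fromℕ = contradiction (toℕ-fromℕ k) (<⇒≢ b<k)
... | ‵fromℕ | ‵inject₁ _ = contradiction (toℕ-fromℕ k) (<⇒≢ (<-trans a<b b<k))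

snoc-pairs-all : ∀ {A : Set} {k} (R : A → A → Set) (f : Fin k → A) x →
  (∀ a b → a <ᶠ b → R (f a) (f b)) → (∀ a → R (f a) x) → ∀ a b → a <ᶠ b → R (snoc f x a) (snoc f x b)
snoc-pairs-all {k = k} R f x inner outer a b a<b with view a | view b
... | _ | ‵inject₁ b′ = snoc-pairs R f x inner a b a<b (subst (_< k) (sym (toℕ-inject₁ b′)) (toℕ<n b′))
... | ‵inject₁ a′ | ‵fromℕ = subst₂ R (sym (snoc-inject₁ f x a′)) (sym (snoc-fromℕ f x)) (outer a′)
... | ‵fromℕ | ‵fromℕ = contradiction a<b (<-irrefl refl)

module _ {n : ℕ} (π : Permutation′ n) where

  graphPoint : Fin n → Point
  graphPoint i = toℕ i , toℕ (π ⟨$⟩ʳ i)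

  IsGraph : Point → Set
  IsGraph p = ∃ λ i → graphPoint i ≡ p

  module _ {X : Point → Set} {R : Point → Point → Set}
           (R-trans : ∀ {p q r} → R p q → R q r → R p r) (X⇒graph : ∀ {p} → X p → IsGraph p) where

    record Positions (k : ℕ) (p : Point) : Set where
      field
        position : Fin (suc k) → Fin n
        last≡ : graphPoint (position (fromℕ k)) ≡ p
        in-X : ∀ a → X (graphPoint (position a))
        related : ∀ a b → a <ᶠ b → R (graphPoint (position a)) (graphPoint (position b))

    chain⇒positions : ∀ {k p} → Chain X R k p → Positions k p
    chain⇒positions [ x ] with X⇒graph x
    ... | i , refl = record
      { position = λ _ → i ; last≡ = refl ; in-X = λ _ → x ; related = λ { Fin.zero Fin.zero () } }
    chain⇒positions (_▷⟨_⟩_ {k} {p} {q} c r x) with X⇒graph x | chain⇒positions c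
    ... | i , refl | ps = record
      { position = ι
      ; last≡ = cong graphPoint (snoc-fromℕ position i)
      ; in-X = in-X′
      ; related = snoc-pairs-all (λ i j → R (graphPoint i) (graphPoint j)) position i related toLast }
      where
      open Positions ps
      ι = snoc position i
      in-X′ : ∀ a → X (graphPoint (ι a))
      in-X′ a with view a
      ... | ‵fromℕ = subst (X ∘ graphPoint) (sym (snoc-fromℕ position i)) x
      ... | ‵inject₁ b = subst (X ∘ graphPoint) (sym (snoc-inject₁ position i b)) (in-X b)
      toLast : ∀ a → R (graphPoint (position a)) (graphPoint i)
      toLast a with view a
      ... | ‵fromℕ = subst (λ p → R p (graphPoint i)) (sym last≡) r
      ... | ‵inject₁ b = R-trans
        (subst (R _) last≡ (related a (fromℕ k) (subst₂ _<_ (sym (toℕ-inject₁ b)) (sym (toℕ-fromℕ k)) (toℕ<n b)))) r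

positions⇒chain : ∀ {X R} k (f : Fin (suc k) → Point) → (∀ a → X (f a)) → (∀ a b → a <ᶠ b → R (f a) (f b)) →
  Chain X R k (f (fromℕ k))
positions⇒chain zero f x _ = [ x Fin.zero ]
positions⇒chain (suc k) f x r =
  positions⇒chain k (f ∘ inject₁) (x ∘ inject₁)
    (λ a b a<b → r _ _ (subst₂ _<_ (sym (toℕ-inject₁ a)) (sym (toℕ-inject₁ b)) a<b))
  ▷⟨ r _ _ (s≤s (≤-reflexive (toℕ-inject₁ (fromℕ k)))) ⟩ x (fromℕ (suc k))

↗-trans : ∀ {p q r} → p ↗ q → q ↗ r → p ↗ r
↗-trans (a , b) (c , d) = <-trans a c , <-trans b d

↘-trans : ∀ {p q r} → p ↘ q → q ↘ r → p ↘ r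
↘-trans (a , b) (c , d) = <-trans a c , <-trans d b

record Represents {n d} (G : Growth d) (π : Permutation′ n) : Set where
  open Growth G
  field
    seed⇒graph : ∀ {p} → Seed p → IsGraph π p
    graph⇒seed : ∀ i → Seed (graphPoint π i)

module _ {n e L : ℕ} {G : Growth (suc e)} {π : Permutation′ n} (rep : Represents G π) where
  open Growth G
  open Represents rep
  private d = suc e

  -- A forbidden pattern is refuted at the seed of its last letter: the earlier letters form a chain
  -- to its lower left and force a box in row `d`, or a first row that is too long.
  seedCorners⇒InS : SeedCorners (suc L) G → InS n d (suc L) π
  seedCorners⇒InS ok = avoids-dec , avoids-inc
    where
    avoids-dec : Avoids (ContainsDec1 d) π
    avoids-dec (ι , ι-inc , ι-dec , first<last) = contradiction (proj₁ (ok (graph⇒seed (ι (fromℕ d)))))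
      (<⇒≢ (chain⇒Λ-last>0 G chain) ∘ sym)
      where
      f : Fin d → Point
      f a = graphPoint π (ι (inject₁ a))
      inject₁-mono : ∀ {a b : Fin d} → a <ᶠ b → inject₁ a <ᶠ inject₁ b
      inject₁-mono {a} {b} = subst₂ _<_ (sym (toℕ-inject₁ a)) (sym (toℕ-inject₁ b))
      inject₁<d : ∀ (a : Fin d) → toℕ (inject₁ a) < d
      inject₁<d a = subst (_< d) (sym (toℕ-inject₁ a)) (toℕ<n a)
      -- The pattern compares its last letter only with the first, which is the largest of the
      -- decreasing letters.
      below-last : ∀ a → proj₂ (f a) < toℕ (π ⟨$⟩ʳ ι (fromℕ d))
      below-last Fin.zero = first<last
      below-last (Fin.suc a) = <-trans (ι-dec Fin.zero _ z<s (inject₁<d (Fin.suc a))) first<last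
      chain = positions⇒chain {Box (toℕ (ι (fromℕ d))) (toℕ (π ⟨$⟩ʳ ι (fromℕ d))) Seed} {_↘_} e f
        (λ a → ι-inc _ _ (subst (toℕ (inject₁ a) <_) (sym (toℕ-fromℕ d)) (inject₁<d a)) , below-last a , graph⇒seed _)
        (λ a b a<b → ι-inc _ _ (inject₁-mono a<b) , ι-dec _ _ (inject₁-mono a<b) (inject₁<d b))
    avoids-inc : Avoids (ContainsInc (suc L)) π
    avoids-inc (ι , ι-inc , π-inc)
      with positions⇒chain {Seed} {_↗_} (suc L) (graphPoint π ∘ ι) (graph⇒seed ∘ ι)
             (λ a b a<b → ι-inc a b a<b , π-inc a b a<b)
    ... | _▷⟨_⟩_ {p = i , j} c (i< , j<) s = contradiction
      (<-≤-trans (proj₂ (ok s)) (≤-trans (chain⇒Λ-first G c) (Λ-mono G 1 i< j<))) (<-irrefl refl)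

  -- Once row `d` is known to be empty at the corner, there are no wraps to its lower left, and a
  -- long first row yields an increasing chain that the seed itself completes to the pattern.
  InS⇒seedCorners : InS n d (suc L) π → SeedCorners (suc L) G
  InS⇒seedCorners (avoids-dec , avoids-inc) {i} {j} s = last≡0 , ≰⇒> λ₁-small
    where
    last≡0 : part (Λ i j) d ≡ 0
    last≡0 with part (Λ i j) d ≟ 0
    ... | yes eq = eq
    ... | no ≢0 with Λ-last>0⇒chain G (n≢0⇒n>0 ≢0) | seed⇒graph s
    ...   | _ , c | k , refl = contradiction contains avoids-dec
      where
      ps = chain⇒positions π {R = _↘_} ↘-trans (seed⇒graph ∘ proj₂ ∘ proj₂) c
      open Positions ps
      ι = snoc position k
      contains : ContainsDec1 d π
      contains = ι
        , snoc-pairs-all _<ᶠ_ position k (λ a b a<b → proj₁ (related a b a<b)) (proj₁ ∘ in-X)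
        , snoc-pairs (λ a b → (π ⟨$⟩ʳ b) <ᶠ (π ⟨$⟩ʳ a)) position k (λ a b a<b → proj₂ (related a b a<b))
        , subst (λ a → (π ⟨$⟩ʳ position Fin.zero) <ᶠ (π ⟨$⟩ʳ a)) (sym (snoc-fromℕ position k))
            (proj₁ (proj₂ (in-X Fin.zero)))
    λ₁-small : suc L ≰ part (Λ i j) 1
    λ₁-small L<λ₁ with Λ-first⇒chain G i j (Λ-last≡0⇒NoWrap G last≡0) L<λ₁
    ... | _ , p↗ , c = avoids-inc
      (position , (λ a b a<b → proj₁ (related a b a<b)) , λ a b a<b → proj₂ (related a b a<b))
      where open Positions (chain⇒positions π {R = _↗_} ↗-trans seed⇒graph (c ▷⟨ p↗ ⟩ s))

-- From permutations to tableaux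

module Forward (e : ℕ) {X : Point → Set} (X? : Decidable X) where
  private d = suc e

  -- An entry takes effect only where both labels are 0; `X⇒seed` shows that every entry of a
  -- permutation matrix lies on such a square.
  raise : ℕ → Bool → ℕ
  raise zero x = if x then 1 else 0
  raise (suc r) _ with suc r <? d
  ... | yes _ = suc (suc r)
  ... | no _ = 1

  next : ℕ → ℕ → Bool → ℕ
  next a b x with a ≟ b
  ... | yes _ = raise a x
  ... | no _ = a

  next-cell : ∀ {a b} x → a ≤ d → Cell d a b (next a b x) (next b a x)
  next-cell {a} {b} x a≤d with a ≟ b | b ≟ a
  ... | no a≢b | no _ = pass a≢b
  ... | no a≢b | yes b≡a = contradiction (sym b≡a) a≢b
  ... | yes a≡b | no b≢a = contradiction (sym a≡b) b≢a
  next-cell {zero} true a≤d | yes refl | yes _ = seed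
  next-cell {zero} false a≤d | yes refl | yes _ = idle
  next-cell {suc r} x a≤d | yes refl | yes _ with suc r <? d
  ... | yes r<d = bump r<d
  ... | no r≮d = wrap (≤-antisym a≤d (≮⇒≥ r≮d))

  h v : ℕ → ℕ → ℕ
  h i zero = 0
  h i (suc j) = next (h i j) (v i j) (does (X? (i , j)))
  v zero j = 0
  v (suc i) j = next (v i j) (h i j) (does (X? (i , j)))

  h≤d : ∀ i j → h i j ≤ d
  v≤d : ∀ i j → v i j ≤ d
  h≤d i zero = z≤n
  h≤d i (suc j) = cell-bounded z<s (h≤d i j) (next-cell {b = v i j} _ (h≤d i j))
  v≤d zero j = z≤n
  v≤d (suc i) j = cell-bounded z<s (v≤d i j) (next-cell {b = h i j} _ (v≤d i j))

  cell : ∀ i j → Cell d (h i j) (v i j) (h i (suc j)) (v (suc i) j)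
  cell i j = next-cell _ (h≤d i j)

  Λ : ℕ → ℕ → Vec ℕ d
  Λ zero j = replicate d 0
  Λ (suc i) j = inc (h i j) (Λ i j)

  inc-cell : ∀ {a b a′ b′} (xs : Vec ℕ d) → Cell d a b a′ b′ → inc a′ (inc b xs) ≡ inc b′ (inc a xs)
  inc-cell {a} {b} xs (pass _) = inc-comm a b xs
  inc-cell xs idle = refl
  inc-cell xs seed = refl
  inc-cell xs (bump _) = refl
  inc-cell xs (wrap _) = refl

  up : ∀ i j → Λ i (suc j) ≡ inc (v i j) (Λ i j)
  up zero j = refl
  up (suc i) j = trans (cong (inc (h i (suc j))) (up i j)) (inc-cell (Λ i j) (cell i j))

  growth : Growth d
  growth = record
    { h = h ; v = v ; Λ = Λ ; h≤d = h≤d ; v≤d = v≤d ; right = λ _ _ → refl ; up = up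
    ; h-bottom = λ _ → refl ; v-left = λ _ → refl ; Λ-origin = refl ; cell = cell }

  open Growth growth using (Seed)

  seed⇒X : ∀ {p} → Seed p → X p
  seed⇒X {i , j} (h≡0 , v≡0 , h′≡1) with h i j | v i j | X? (i , j)
  ... | zero | zero | yes x = x
  seed⇒X (_ , _ , ()) | zero | zero | no _

  -- A nonzero label at an entry would stem from an earlier seed in the same column or row, that is,
  -- from a second entry there.
  X⇒seed : (∀ {i j j′} → X (i , j) → X (i , j′) → j ≡ j′) → (∀ {i i′ j} → X (i , j) → X (i′ , j) → i ≡ i′) →
    ∀ {p} → X p → Seed p
  X⇒seed col row {i , j} x = h≡0 , v≡0 , h′≡1
    where
    h≡0 : h i j ≡ 0
    h≡0 with h i j ≟ 0
    ... | yes eq = eq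
    ... | no ≢0 with seed-below growth j ≢0
    ...   | m , m<j , s = contradiction (col (seed⇒X s) x) (<⇒≢ m<j)
    v≡0 : v i j ≡ 0
    v≡0 with v i j ≟ 0
    ... | yes eq = eq
    ... | no ≢0 with seed-below (transpose growth) i ≢0
    ...   | m , m<i , s = contradiction (row (seed⇒X (Bump-transpose (transpose growth) {i = j} {m} s)) x) (<⇒≢ m<i)
    h′≡1 : h i (suc j) ≡ 1
    h′≡1 rewrite h≡0 | v≡0 with X? (i , j)
    ... | yes _ = refl
    ... | no ¬x = contradiction x ¬x

module _ {n : ℕ} (π : Permutation′ n) where

  isGraph? : Decidable (IsGraph π)
  isGraph? p = any? λ i → ≡-dec _≟_ _≟_ (graphPoint π i) p

  graph-col : ∀ {i j j′} → IsGraph π (i , j) → IsGraph π (i , j′) → j ≡ j′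
  graph-col (k , refl) (l , eq) with ,-injective eq
  ... | l≡k , refl = cong (toℕ ∘ (π ⟨$⟩ʳ_)) (sym (toℕ-injective l≡k))

  graph-row : ∀ {i i′ j} → IsGraph π (i , j) → IsGraph π (i′ , j) → i ≡ i′
  graph-row (k , refl) (l , eq) with ,-injective eq
  ... | refl , πl≡πk = cong toℕ (trans (sym (inverseˡ π))
    (trans (cong (π ⟨$⟩ˡ_) (sym (toℕ-injective πl≡πk))) (inverseˡ π)))

  permutationGrowth : ∀ e → Growth (suc e)
  permutationGrowth e = Forward.growth e isGraph?

  permutationGrowth-represents : ∀ e → Represents (permutationGrowth e) π
  permutationGrowth-represents e = record
    { seed⇒graph = Forward.seed⇒X e isGraph?
    ; graph⇒seed = λ i → Forward.X⇒seed e isGraph? graph-col graph-row (i , refl) }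

transpose-represents : ∀ {n d} {G : Growth d} {π : Permutation′ n} →
  Represents G π → Represents (transpose G) (flip π)
transpose-represents {G = G} {π} rep = record
  { seed⇒graph = λ s → flipped (seed⇒graph (Bump-transpose (transpose G) s))
  ; graph⇒seed = λ i → subst (λ k → Growth.Seed (transpose G) (toℕ k , toℕ (π ⟨$⟩ˡ i))) (inverseʳ π)
      (Bump-transpose G (graph⇒seed (π ⟨$⟩ˡ i))) }
  where
  open Represents rep
  flipped : ∀ {i j} → IsGraph π (j , i) → IsGraph (flip π) (i , j)
  flipped (k , refl) = π ⟨$⟩ʳ k , cong (toℕ (π ⟨$⟩ʳ k) ,_) (cong toℕ (inverseˡ π))

Represents-≈ : ∀ {n d} {G : Growth d} {π σ : Permutation′ n} → π ≈ σ → Represents G π → Represents G σ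
Represents-≈ {G = G} π≈σ rep = record
  { seed⇒graph = λ s → let i , eq = seed⇒graph s in i , trans (cong (λ j → toℕ i , toℕ j) (sym (π≈σ i))) eq
  ; graph⇒seed = λ i → subst (λ j → Growth.Seed G (toℕ i , toℕ j)) (π≈σ i) (graph⇒seed i) }
  where open Represents rep

module _ {n d : ℕ} {G₁ G₂ : Growth d} {π : Permutation′ n} (rep₁ : Represents G₁ π) (rep₂ : Represents G₂ π) where
  Represents⇒Λ≡ : ∀ i j → Growth.Λ G₁ i j ≡ Growth.Λ G₂ i j
  Represents⇒Λ≡ = Λ-unique G₁ G₂ (transfer rep₁ rep₂) (transfer rep₂ rep₁)
    where
    transfer : ∀ {G₁ G₂ : Growth d} → Represents G₁ π → Represents G₂ π → ∀ {p} → Growth.Seed G₁ p → Growth.Seed G₂ p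
    transfer rep₁ rep₂ s with Represents.seed⇒graph rep₁ s
    ... | i , refl = Represents.graph⇒seed rep₂ i

-- Tableaux on the boundary of a diagram

topTableau : ∀ {d} → Growth d → ∀ n → Vec (Vec ℕ d) (suc n)
topTableau G n = tabulate λ i → Growth.Λ G (toℕ i) n

tableaux : ∀ {d} → Growth d → ∀ n → TabPair n d
tableaux G n = topTableau G n , topTableau (transpose G) n

tableaux-cong : ∀ {d} {G₁ G₂ : Growth d} {n} → (∀ i j → Growth.Λ G₁ i j ≡ Growth.Λ G₂ i j) →
  tableaux G₁ n ≡ tableaux G₂ n
tableaux-cong {n = n} Λ≡ = cong₂ _,_ (tabulate-cong λ i → Λ≡ (toℕ i) n) (tabulate-cong λ j → Λ≡ n (toℕ j))

-- Interlacing compares a row after the step with the preceding row, cyclically, before it. If the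
-- box is in the later row, the preceding one has not changed and the new partition gives the
-- inequality; otherwise the old partition does.
cylindric-prec : ∀ {e L r} {xs : Vec ℕ (suc e)} → 1 ≤ L → suc r ≤ suc e → Cylindric (suc e) L xs →
  Cylindric (suc e) L (inc (suc r) xs) → Prec (suc e) L xs (inc (suc r) xs)
cylindric-prec {e} {L} {r} {xs} 1≤L r<d cα cβ = (λ i _ _ → part-inc-≤ xs (suc r) i) , interlace , wraps
  where
  d = suc e
  open ≤-Reasoning
  interlace : ∀ i → 1 ≤ i → i < d → part (inc (suc r) xs) (suc i) ≤ part xs i
  interlace (suc i) _ i<d with suc r ≟ suc (suc i)
  ... | no a≢ = begin
    part (inc (suc r) xs) (suc (suc i)) ≡⟨ part-inc-≢ xs a≢ ⟩
    part xs (suc (suc i))               ≤⟨ cα (below i<d) ⟩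
    part xs (suc i) + 0                 ≡⟨ +-identityʳ _ ⟩
    part xs (suc i)                     ∎
  ... | yes refl = begin
    part (inc (suc r) xs) (suc (suc i)) ≤⟨ cβ (below i<d) ⟩
    part (inc (suc r) xs) (suc i) + 0   ≡⟨ +-identityʳ _ ⟩
    part (inc (suc r) xs) (suc i)       ≡⟨ part-inc-≢ xs {i = suc i} 1+n≢n ⟩
    part xs (suc i)                     ∎
  wraps′ : part (inc (suc r) xs) 1 ≤ L + part xs d
  wraps′ with suc r ≟ 1 | suc r ≟ d
  ... | no a≢1 | _ = begin
    part (inc (suc r) xs) 1 ≡⟨ part-inc-≢ xs a≢1 ⟩
    part xs 1               ≤⟨ cα around ⟩
    part xs d + L           ≡⟨ +-comm _ L ⟩
    L + part xs d           ∎
  ... | yes refl | no a≢d = begin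
    part (inc 1 xs) 1       ≤⟨ cβ around ⟩
    part (inc 1 xs) d + L   ≡⟨ cong (_+ L) (part-inc-≢ xs a≢d) ⟩
    part xs d + L           ≡⟨ +-comm _ L ⟩
    L + part xs d           ∎
  -- For `d = 1` the seam compares row 1 with itself one box earlier, which `1 ≤ L` covers.
  ... | yes refl | yes refl = ≤-trans (≤-reflexive (part-inc-≡ xs r<d)) (+-monoˡ-≤ (part xs 1) 1≤L)
  wraps : part (inc (suc r) xs) 1 ∸ L ≤ part xs d
  wraps = m≤n+o⇒m∸n≤o _ L wraps′

Cylindric⇒IsDPartition : ∀ {e L} {xs : Vec ℕ (suc e)} → Cylindric (suc e) L xs → IsDPartition xs
Cylindric⇒IsDPartition c (suc i) _ i<d = ≤-trans (c (below i<d)) (≤-reflexive (+-identityʳ _))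

topTableau-cylindric : ∀ {n e L} (G : Growth (suc e)) → 1 ≤ L → SeedCorners L G →
  (∀ (i : Fin n) → Growth.h G (toℕ i) n ≢ 0) → IsCylSYT n (suc e) L (topTableau G n)
topTableau-cylindric {n} {e} {L} G 1≤L ok h≢0 =
    Λ-bottom (transpose G) n
  , (λ i → subst IsDPartition (sym (lookup-top i)) (Cylindric⇒IsDPartition (Λ-cylindric G ok (toℕ i) n)))
  , λ i → subst₂ (λ α β → Prec d L α β × size β ≡ suc (size α))
      (sym (lookup-inject₁ i)) (sym (lookup-top (Fin.suc i))) (one-box i)
  where
  open Growth G
  d = suc e
  lookup-top : ∀ i → lookup (topTableau G n) i ≡ Λ (toℕ i) n
  lookup-top = lookup∘tabulate (λ i → Λ (toℕ i) n)
  lookup-inject₁ : ∀ i → lookup (topTableau G n) (inject₁ i) ≡ Λ (toℕ i) n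
  lookup-inject₁ i = trans (lookup-top (inject₁ i)) (cong (λ k → Λ k n) (toℕ-inject₁ i))
  step : ∀ r i → r ≢ 0 → r ≤ d → Λ (suc i) n ≡ inc r (Λ i n) →
    Prec d L (Λ i n) (Λ (suc i) n) × size (Λ (suc i) n) ≡ suc (size (Λ i n))
  step zero i r≢0 _ _ = contradiction refl r≢0
  step (suc r) i _ r≤d eq rewrite eq =
    cylindric-prec 1≤L r≤d (Λ-cylindric G ok i n) (subst (Cylindric d L) eq (Λ-cylindric G ok (suc i) n))
    , sum-inc (Λ i n) r≤d
  one-box : ∀ (i : Fin n) →
    Prec d L (Λ (toℕ i) n) (Λ (suc (toℕ i)) n) × size (Λ (suc (toℕ i)) n) ≡ suc (size (Λ (toℕ i) n))
  one-box i = step (h (toℕ i) n) (toℕ i) (h≢0 i) (h≤d (toℕ i) n) (right (toℕ i) n)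

represented-nonzero : ∀ {n d} {G : Growth d} {π : Permutation′ n} → Represents G π →
  ∀ (i : Fin n) → Growth.h G (toℕ i) n ≢ 0
represented-nonzero {G = G} {π} rep i = seed⇒nonzero G (Represents.graph⇒seed rep i) (toℕ<n (π ⟨$⟩ʳ i))

tableaux-InT : ∀ {n e L} {G : Growth (suc e)} {π : Permutation′ n} → Represents G π → SeedCorners (suc L) G →
  InT n (suc e) (suc L) (tableaux G n)
tableaux-InT {n} {G = G} rep ok =
    topTableau-cylindric G z<s ok (represented-nonzero rep)
  , topTableau-cylindric (transpose G) z<s (SeedCorners-transpose G ok)
      (represented-nonzero (transpose-represents rep))
  , trans (lookup∘tabulate (λ i → Λ (toℕ i) n) (fromℕ n))
      (trans (cong₂ Λ (toℕ-fromℕ n) (sym (toℕ-fromℕ n))) (sym (lookup∘tabulate (λ j → Λ n (toℕ j)) (fromℕ n))))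
  where open Growth G

-- Equal boundaries give equal partitions in the square, hence equal labels, so that every entry of
-- `π` is also a seed of `G₂` and thus an entry of `σ`.
tableaux-injective : ∀ {n e L} {G₁ G₂ : Growth (suc e)} {π σ : Permutation′ n} → Represents G₁ π → Represents G₂ σ →
  SeedCorners (suc L) G₁ → SeedCorners (suc L) G₂ → tableaux G₁ n ≡ tableaux G₂ n → π ≈ σ
tableaux-injective {n} {e} {G₁ = G₁} {G₂} {π} {σ} rep₁ rep₂ ok₁ ok₂ eq i =
  toℕ-injective (graph-col σ (Represents.seed⇒graph rep₂ seed₂) (i , refl))
  where
  open ≡-Reasoning
  module G₁ = Growth G₁
  module G₂ = Growth G₂
  boundary : ∀ {G₁ G₂ : Growth (suc e)} → topTableau G₁ n ≡ topTableau G₂ n →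
    ∀ {i} → i ≤ n → Growth.Λ G₁ i n ≡ Growth.Λ G₂ i n
  boundary {G₁} {G₂} eq {i} i≤n = subst (λ k → Growth.Λ G₁ k n ≡ Growth.Λ G₂ k n) (toℕ-fromℕ< (s≤s i≤n)) (begin
    Growth.Λ G₁ (toℕ k) n      ≡⟨ lookup∘tabulate (λ i → Growth.Λ G₁ (toℕ i) n) k ⟨
    lookup (topTableau G₁ n) k ≡⟨ cong (λ T → lookup T k) eq ⟩
    lookup (topTableau G₂ n) k ≡⟨ lookup∘tabulate (λ i → Growth.Λ G₂ (toℕ i) n) k ⟩
    Growth.Λ G₂ (toℕ k) n      ∎)
    where k = fromℕ< (s≤s i≤n)
  Λ≡ : ∀ {i j} → i ≤ n → j ≤ n → G₁.Λ i j ≡ G₂.Λ i j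
  Λ≡ {i} {j} i≤n j≤n = boundary-determines-Λ G₁ G₂ ok₁ ok₂ (boundary {G₁} {G₂} (cong proj₁ eq))
    (boundary {transpose G₁} {transpose G₂} (cong proj₂ eq)) (n ∸ i) (n ∸ j) (m∸n+n≡m i≤n) (m∸n+n≡m j≤n)
  seed₂ : G₂.Seed (graphPoint π i)
  seed₂ with Represents.graph⇒seed rep₁ i
  ... | h≡0 , v≡0 , h′≡1 =
      trans (sym (Λ≡⇒h≡ G₁ G₂ (Λ≡ i≤n j≤n) (Λ≡ i<n j≤n))) h≡0
    , trans (sym (Λ≡⇒h≡ (transpose G₁) (transpose G₂) (Λ≡ i≤n j≤n) (Λ≡ i≤n j<n))) v≡0
    , trans (sym (Λ≡⇒h≡ G₁ G₂ (Λ≡ i≤n j<n) (Λ≡ i<n j<n))) h′≡1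
    where
    i<n = toℕ<n i
    i≤n = <⇒≤ i<n
    j<n = toℕ<n (π ⟨$⟩ʳ i)
    j≤n = <⇒≤ j<n

-- From tableaux to permutations

record Step {d} (xs ys : Vec ℕ d) : Set where
  field
    label : ℕ
    label≤d : label ≤ d
    inc-label : inc label xs ≡ ys

open Step

inc≡∅ : ∀ {d a} {xs : Vec ℕ d} → a ≤ d → inc a xs ≡ replicate d 0 → a ≡ 0 × xs ≡ replicate d 0
inc≡∅ {a = zero} _ eq = refl , eq
inc≡∅ {d} {suc a} {xs} a<d eq = contradiction (begin
  suc (sum xs)          ≡⟨ sum-inc xs a<d ⟨
  sum (inc (suc a) xs)  ≡⟨ cong sum eq ⟩
  sum (replicate d 0)   ≡⟨ sum-∅ d ⟩
  0                     ∎) λ () where open ≡-Reasoning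

-- The boundaries and the grid are indexed by the distance to the upper right corner.
module Backward {e L : ℕ} (n : ℕ) (1≤L : 1 ≤ L) (A C : ℕ → Vec ℕ (suc e)) (A₀≡C₀ : A 0 ≡ C 0)
  (A-cylindric : ∀ k → Cylindric (suc e) L (A k)) (C-cylindric : ∀ k → Cylindric (suc e) L (C k))
  (A-step : ∀ k → Step (A (suc k)) (A k)) (C-step : ∀ k → Step (C (suc k)) (C k))
  (Aₙ≡∅ : A n ≡ replicate (suc e) 0) (Cₙ≡∅ : C n ≡ replicate (suc e) 0) where
  private d = suc e

  mutual
    B : ℕ → ℕ → Vec ℕ d
    B zero j = C j
    B (suc i) zero = A (suc i)
    B (suc i) (suc j) = Corner.vertex (B-corner i j)

    B-cylindric : ∀ i j → Cylindric d L (B i j)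
    B-cylindric zero j = C-cylindric j
    B-cylindric (suc i) zero = A-cylindric (suc i)
    B-cylindric (suc i) (suc j) = Corner.cylindric (B-corner i j)

    hB : ∀ i j → Step (B (suc i) j) (B i j)
    hB i (suc j) = record { label≤d = Corner.a≤d (B-corner i j) ; inc-label = Corner.bottom (B-corner i j) }
    hB zero zero = subst (Step (A 1)) A₀≡C₀ (A-step 0)
    hB (suc i) zero = A-step (suc i)

    vB : ∀ i j → Step (B i (suc j)) (B i j)
    vB zero j = C-step j
    vB (suc i) j = record { label≤d = Corner.b≤d (B-corner i j) ; inc-label = Corner.left (B-corner i j) }

    B-corner : ∀ i j → Corner {L = L} (B i (suc j)) (B (suc i) j) (label (hB i j)) (label (vB i j))
    B-corner i j = corner 1≤L (label≤d (hB i j)) (label≤d (vB i j)) (inc-label (hB i j)) (inc-label (vB i j))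
      (B-cylindric i (suc j)) (B-cylindric (suc i) j) (B-cylindric i j)

  B-top : ∀ i → B i 0 ≡ A i
  B-top zero = sym A₀≡C₀
  B-top (suc i) = refl

  -- Partitions shrink towards the left, and the bottom row begins at the empty partition `C n`.
  B-bottom : ∀ i → B i n ≡ replicate d 0
  B-bottom zero = Cₙ≡∅
  B-bottom (suc i) = proj₂ (inc≡∅ (label≤d (hB i n)) (trans (inc-label (hB i n)) (B-bottom i)))

  B-left : ∀ j → B n j ≡ replicate d 0
  B-left zero = trans (B-top n) Aₙ≡∅
  B-left (suc j) = proj₂ (inc≡∅ (label≤d (vB n j)) (trans (inc-label (vB n j)) (B-left j)))

  Λ : ℕ → ℕ → Vec ℕ d
  Λ i j = B (n ∸ i) (n ∸ j)

  ∸-inside : ∀ {i} → i < n → n ∸ i ≡ suc (n ∸ suc i)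
  ∸-inside i<n = +-∸-assoc 1 i<n

  ∸-outside : ∀ {i} → i ≮ n → n ∸ i ≡ n ∸ suc i
  ∸-outside {i} i≮n = trans (m≤n⇒m∸n≡0 n≤i) (sym (m≤n⇒m∸n≡0 (m≤n⇒m≤1+n n≤i)))
    where n≤i = ≮⇒≥ i≮n

  -- Beyond the square, truncated subtraction makes `Λ` repeat its boundary values, so the labels
  -- there are 0.
  h v : ℕ → ℕ → ℕ
  h i j with i <? n
  ... | yes _ = label (hB (n ∸ suc i) (n ∸ j))
  ... | no _ = 0
  v i j with j <? n
  ... | yes _ = label (vB (n ∸ i) (n ∸ suc j))
  ... | no _ = 0

  h≤d : ∀ i j → h i j ≤ d
  h≤d i j with i <? n
  ... | yes _ = label≤d (hB (n ∸ suc i) (n ∸ j))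
  ... | no _ = z≤n

  v≤d : ∀ i j → v i j ≤ d
  v≤d i j with j <? n
  ... | yes _ = label≤d (vB (n ∸ i) (n ∸ suc j))
  ... | no _ = z≤n

  right : ∀ i j → Λ (suc i) j ≡ inc (h i j) (Λ i j)
  right i j with i <? n
  ... | yes i<n rewrite ∸-inside i<n = sym (inc-label (hB (n ∸ suc i) (n ∸ j)))
  ... | no i≮n = cong (λ k → B k (n ∸ j)) (sym (∸-outside i≮n))

  up : ∀ i j → Λ i (suc j) ≡ inc (v i j) (Λ i j)
  up i j with j <? n
  ... | yes j<n rewrite ∸-inside j<n = sym (inc-label (vB (n ∸ i) (n ∸ suc j)))
  ... | no j≮n = cong (B (n ∸ i)) (sym (∸-outside j≮n))

  h-bottom : ∀ i → h i 0 ≡ 0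
  h-bottom i = proj₁ (inc≡∅ {xs = Λ i 0} (h≤d i 0) (trans (sym (right i 0)) (B-bottom (n ∸ suc i))))

  v-left : ∀ j → v 0 j ≡ 0
  v-left j = proj₁ (inc≡∅ {xs = Λ 0 j} (v≤d 0 j) (trans (sym (up 0 j)) (B-left (n ∸ suc j))))

  cell-right : ∀ {a} → Cell d a 0 a 0
  cell-right {zero} = idle
  cell-right {suc a} = pass λ ()

  cell : ∀ i j → Cell d (h i j) (v i j) (h i (suc j)) (v (suc i) j)
  cell i j with i <? n | j <? n
  ... | yes i<n | yes j<n rewrite ∸-inside i<n | ∸-inside j<n = Corner.cell (B-corner (n ∸ suc i) (n ∸ suc j))
  ... | yes i<n | no j≮n rewrite ∸-outside j≮n = cell-right
  ... | no i≮n | yes j<n rewrite ∸-outside i≮n = cell-sym cell-right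
  ... | no _ | no _ = idle

  growth : Growth d
  growth = record
    { h = h ; v = v ; Λ = Λ ; h≤d = h≤d ; v≤d = v≤d ; right = right ; up = up
    ; h-bottom = h-bottom ; v-left = v-left ; Λ-origin = B-bottom n ; cell = cell }

  seed-inside : ∀ {i j} → Growth.Seed growth (i , j) → i < n × j < n
  seed-inside {i} {j} s = inside s , inside-transposed (proj₂ (proj₂ (Bump-transpose growth s)))
    where
    inside : Growth.Seed growth (i , j) → i < n
    inside (_ , _ , h′≡1) with i <? n
    ... | yes i<n = i<n
    inside (_ , _ , ()) | no _
    inside-transposed : v (suc i) j ≡ 1 → j < n
    inside-transposed v′≡1 with j <? n
    ... | yes j<n = j<n
    inside-transposed () | no _

  seedCorners : SeedCorners L growth
  seedCorners {i} {j} s = uncurry (inside s) (seed-inside s)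
    where
    inside : Growth.Seed growth (i , j) → i < n → j < n → SeedCorner L (Λ i j)
    inside (h≡0 , v≡0 , h′≡1) i<n j<n with i <? n | j <? n
    ... | no i≮n | _ = contradiction i<n i≮n
    ... | _ | no j≮n = contradiction j<n j≮n
    ... | yes _ | yes _ rewrite ∸-inside i<n | ∸-inside j<n =
      Corner.seedCorner (B-corner (n ∸ suc i) (n ∸ suc j)) h≡0 v≡0 h′≡1

  Λ-top : ∀ i → Λ i n ≡ A (n ∸ i)
  Λ-top i = trans (cong (B (n ∸ i)) (n∸n≡0 n)) (B-top (n ∸ i))

  Λ-side : ∀ j → Λ n j ≡ C (n ∸ j)
  Λ-side j = cong (λ k → B k (n ∸ j)) (n∸n≡0 n)

  growth-exists : ∃ λ (G : Growth d) → SeedCorners L G × (∀ {i j} → Growth.Seed G (i , j) → i < n × j < n) ×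
    (∀ i → Growth.Λ G i n ≡ A (n ∸ i)) × (∀ j → Growth.Λ G n j ≡ C (n ∸ j))
  growth-exists = growth , seedCorners , seed-inside , Λ-top , Λ-side

module _ {n d : ℕ} (G : Growth d) (seed-inside : ∀ {i j} → Growth.Seed G (i , j) → i < n × j < n)
  (h≢0 : ∀ {i} → i < n → Growth.h G i n ≢ 0) (v≢0 : ∀ {j} → j < n → Growth.v G n j ≢ 0) where
  open Growth G

  growth⇒permutation : ∃ λ (π : Permutation′ n) → Represents G π
  growth⇒permutation = π , record
    { seed⇒graph = λ s → fromℕ< (proj₁ (seed-inside s)) , cong₂ _,_ (toℕ-fromℕ< _)
        (seed-unique G (seed-row (fromℕ< _)) (subst (λ i → Seed (i , _)) (sym (toℕ-fromℕ< _)) s))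
    ; graph⇒seed = seed-row }
    where
    seed-in-column : ∀ (i : Fin n) → ∃ λ (j : Fin n) → Seed (toℕ i , toℕ j)
    seed-in-column i with seed-below G n (h≢0 (toℕ<n i))
    ... | m , m<n , s = fromℕ< m<n , subst (λ j → Seed (toℕ i , j)) (sym (toℕ-fromℕ< m<n)) s
    seed-in-row : ∀ (j : Fin n) → ∃ λ (i : Fin n) → Seed (toℕ i , toℕ j)
    seed-in-row j with seed-below (transpose G) n (v≢0 (toℕ<n j))
    ... | m , m<n , s = fromℕ< m<n ,
      subst (λ i → Seed (i , toℕ j)) (sym (toℕ-fromℕ< m<n)) (Bump-transpose (transpose G) s)
    π : Permutation′ n
    π = permutation (proj₁ ∘ seed-in-column) (proj₁ ∘ seed-in-row)
      (λ j → toℕ-injective (seed-unique G (proj₂ (seed-in-column _)) (proj₂ (seed-in-row j))))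
      (λ i → toℕ-injective (seed-unique (transpose G) (Bump-transpose G (proj₂ (seed-in-row _)))
        (Bump-transpose G (proj₂ (seed-in-column i)))))
    seed-row : ∀ i → Seed (graphPoint π i)
    seed-row i = proj₂ (seed-in-column i)

-- Clamped indexing: beyond its end a vector repeats its last entry.
at : ∀ {A : Set} {n} → Vec A (suc n) → ℕ → A
at (x ∷ []) _ = x
at (x ∷ y ∷ xs) zero = x
at (x ∷ y ∷ xs) (suc k) = at (y ∷ xs) k

at-toℕ : ∀ {A : Set} {n} (xs : Vec A (suc n)) i → at xs (toℕ i) ≡ lookup xs i
at-toℕ (x ∷ []) Fin.zero = refl
at-toℕ (x ∷ y ∷ xs) Fin.zero = refl
at-toℕ (x ∷ y ∷ xs) (Fin.suc i) = at-toℕ (y ∷ xs) i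

at-inject₁ : ∀ {A : Set} {n} (xs : Vec A (suc n)) i → at xs (toℕ i) ≡ lookup xs (inject₁ {n} i)
at-inject₁ xs i = trans (cong (at xs) (sym (toℕ-inject₁ i))) (at-toℕ xs (inject₁ i))

at-fromℕ : ∀ {A : Set} {n} (xs : Vec A (suc n)) → at xs n ≡ lookup xs (fromℕ n)
at-fromℕ {n = n} xs = trans (cong (at xs) (sym (toℕ-fromℕ n))) (at-toℕ xs (fromℕ n))

-- A tableau as boundary data

module Tableau {n e L : ℕ} (T : Vec (Vec ℕ (suc e)) (suc n)) (cyl : IsCylSYT n (suc e) L T) where
  private d = suc e

  at-start : at T 0 ≡ replicate d 0
  at-start = trans (at-toℕ T Fin.zero) (proj₁ cyl)

  one-box : ∀ {k} → k < n → (Prec d L (at T k) (at T (suc k)) × size (at T (suc k)) ≡ suc (size (at T k)))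
  one-box {k} k<n = subst (λ k → Prec d L (at T k) (at T (suc k)) × size (at T (suc k)) ≡ suc (size (at T k)))
    (toℕ-fromℕ< k<n) (subst₂ (λ α β → Prec d L α β × size β ≡ suc (size α)) (sym (at-inject₁ T i))
      (sym (at-toℕ T (Fin.suc i))) (proj₂ (proj₂ cyl) i))
    where i = fromℕ< k<n

  -- The seam inequality of a partition is read off the step that arrives at it; the empty start
  -- satisfies it trivially.
  cylindric-at : ∀ {k} → k ≤ n → Cylindric d L (at T k)
  cylindric-at {k} k≤n (below i<d) = ≤-trans
    (subst IsDPartition (trans (sym (at-toℕ T j)) (cong (at T) (toℕ-fromℕ< (s≤s k≤n))))
      (proj₁ (proj₂ cyl) j) _ z<s i<d) (m≤m+n _ 0)
    where j = fromℕ< (s≤s k≤n)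
  cylindric-at {zero} _ around rewrite at-start = z≤n
  cylindric-at {suc k} k<n around with one-box k<n
  ... | (α⊆β , _ , wraps) , _ = begin
    part (at T (suc k)) 1             ≤⟨ m≤n+m∸n _ L ⟩
    L + (part (at T (suc k)) 1 ∸ L)   ≤⟨ +-monoʳ-≤ L (≤-trans wraps (α⊆β d z<s ≤-refl)) ⟩
    L + part (at T (suc k)) d         ≡⟨ +-comm L _ ⟩
    part (at T (suc k)) d + L         ∎ where open ≤-Reasoning

  step-at : ∀ {k} → k < n → Step (at T k) (at T (suc k))
  step-at k<n with one-box k<n
  ... | (α⊆β , _) , size≡ with ⊆-sum-suc⇒inc α⊆β size≡
  ...   | r , r<d , eq = record { label≤d = r<d ; inc-label = eq }

  reversed : ℕ → Vec ℕ d
  reversed k = at T (n ∸ k)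

  reversed-step : ∀ k → Step (reversed (suc k)) (reversed k)
  reversed-step k with k <? n
  ... | yes k<n = subst (Step (reversed (suc k))) (cong (at T) (sym (+-∸-assoc 1 k<n)))
    (step-at (subst (_≤ n) (+-∸-assoc 1 k<n) (m∸n≤m n k)))
  ... | no k≮n = record
    { label≤d = z≤n
    ; inc-label = cong (at T) (trans (m≤n⇒m∸n≡0 (m≤n⇒m≤1+n n≤k)) (sym (m≤n⇒m∸n≡0 n≤k))) }
    where n≤k = ≮⇒≥ k≮n

  reversed-cylindric : ∀ k → Cylindric d L (reversed k)
  reversed-cylindric k = cylindric-at (m∸n≤m n k)

  reversed-start : reversed n ≡ replicate d 0
  reversed-start = trans (cong (at T) (n∸n≡0 n)) at-start

  reversed² : ∀ {k} → k ≤ n → reversed (n ∸ k) ≡ at T k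
  reversed² k≤n = cong (at T) (m∸[m∸n]≡n k≤n)

  module _ (G : Growth d) (Λ≡ : ∀ {i} → i ≤ n → Growth.Λ G i n ≡ at T i) where
    open Growth G

    top-nonzero : ∀ {i} → i < n → h i n ≢ 0
    top-nonzero {i} i<n h≡0 = 1+n≢n (begin
      suc (size (at T i))    ≡⟨ proj₂ (one-box i<n) ⟨
      size (at T (suc i))    ≡⟨ cong size (Λ≡ i<n) ⟨
      size (Λ (suc i) n)     ≡⟨ cong size (right i n) ⟩
      size (inc (h i n) (Λ i n)) ≡⟨ cong (λ a → size (inc a (Λ i n))) h≡0 ⟩
      size (Λ i n)           ≡⟨ cong size (Λ≡ (<⇒≤ i<n)) ⟩
      size (at T i)          ∎) where open ≡-Reasoning

    topTableau≡ : topTableau G n ≡ T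
    topTableau≡ = trans (tabulate-cong λ i → trans (Λ≡ (s≤s⁻¹ (toℕ<n i))) (at-toℕ T i)) (tabulate∘lookup T)

tableaux-surjective : ∀ {n e L} → 1 ≤ L → (PQ : TabPair n (suc e)) → InT n (suc e) L PQ →
  ∃ λ (π : Permutation′ n) → ∃ λ (G : Growth (suc e)) → Represents G π × SeedCorners L G × tableaux G n ≡ PQ
tableaux-surjective {n} {e} {L} 1≤L (P , Q) (P-cyl , Q-cyl , shape≡) = fromGrowth
  (Backward.growth-exists n 1≤L P.reversed Q.reversed (trans (at-fromℕ P) (trans shape≡ (sym (at-fromℕ Q))))
    P.reversed-cylindric Q.reversed-cylindric P.reversed-step Q.reversed-step P.reversed-start Q.reversed-start)
  where
  module P = Tableau {L = L} P P-cyl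
  module Q = Tableau {L = L} Q Q-cyl
  fromGrowth : (∃ λ (G : Growth (suc e)) → SeedCorners L G × (∀ {i j} → Growth.Seed G (i , j) → i < n × j < n) ×
    (∀ i → Growth.Λ G i n ≡ P.reversed (n ∸ i)) × (∀ j → Growth.Λ G n j ≡ Q.reversed (n ∸ j))) →
    ∃ λ (π : Permutation′ n) → ∃ λ (G : Growth (suc e)) → Represents G π × SeedCorners L G × tableaux G n ≡ (P , Q)
  fromGrowth (G , ok , inside , top , side) =
      proj₁ π , G , proj₂ π , ok , cong₂ _,_ (P.topTableau≡ G P≡) (Q.topTableau≡ (transpose G) Q≡)
    where
    P≡ : ∀ {i} → i ≤ n → Growth.Λ G i n ≡ at P i
    P≡ {i} i≤n = trans (top i) (P.reversed² i≤n)
    Q≡ : ∀ {j} → j ≤ n → Growth.Λ G n j ≡ at Q j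
    Q≡ {j} j≤n = trans (side j) (Q.reversed² j≤n)
    π : ∃ (Represents G)
    π = growth⇒permutation G inside (P.top-nonzero G P≡) (Q.top-nonzero (transpose G) Q≡)

-- Any diagrams representing the permutations give the same tableaux, by `Represents⇒Λ≡`; the choice
-- of `G` can therefore stay abstract.
module Bijection {n e L : ℕ} (G : Permutation′ n → Growth (suc e)) (rep : ∀ π → Represents (G π) π) where

  Φ : (π : Permutation′ n) → InS n (suc e) (suc L) π → TabPair n (suc e)
  Φ π _ = tableaux (G π) n

  corners : ∀ π → InS n (suc e) (suc L) π → SeedCorners (suc L) (G π)
  corners π = InS⇒seedCorners (rep π)

  Φ-InT : ∀ π (h : InS n (suc e) (suc L) π) → InT n (suc e) (suc L) (Φ π h)
  Φ-InT π h = tableaux-InT (rep π) (corners π h)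

  Φ-cong : ∀ π σ (h : InS n (suc e) (suc L) π) (h′ : InS n (suc e) (suc L) σ) → π ≈ σ → Φ π h ≡ Φ σ h′
  Φ-cong π σ _ _ π≈σ = tableaux-cong {G₁ = G π} {G σ} (Represents⇒Λ≡ (Represents-≈ π≈σ (rep π)) (rep σ))

  Φ-injective : ∀ π σ (h : InS n (suc e) (suc L) π) (h′ : InS n (suc e) (suc L) σ) → Φ π h ≡ Φ σ h′ → π ≈ σ
  Φ-injective π σ h h′ = tableaux-injective (rep π) (rep σ) (corners π h) (corners σ h′)

  Φ-surjective : ∀ PQ → InT n (suc e) (suc L) PQ →
    Σ (Permutation′ n) λ π → Σ (InS n (suc e) (suc L) π) λ h → Φ π h ≡ PQ
  Φ-surjective PQ inT = fromGrowth (tableaux-surjective z<s PQ inT)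
    where
    fromGrowth : (∃ λ π → ∃ λ G′ → Represents G′ π × SeedCorners (suc L) G′ × tableaux G′ n ≡ PQ) →
      Σ (Permutation′ n) λ π → Σ (InS n (suc e) (suc L) π) λ h → Φ π h ≡ PQ
    fromGrowth (π , G′ , rep′ , ok , tableaux≡) = π , seedCorners⇒InS rep′ ok ,
      trans (tableaux-cong {G₁ = G π} {G′} (Represents⇒Λ≡ (rep π) rep′)) tableaux≡

  -- That the inverse avoids both patterns follows from the symmetry of `SeedCorners` under
  -- transposition, without inspecting the patterns.
  Φ-flip : ∀ π (h : InS n (suc e) (suc L) π) →
    Σ (InS n (suc e) (suc L) (flip π)) λ h′ → Φ (flip π) h′ ≡ swapPair (Φ π h)
  Φ-flip π h = seedCorners⇒InS rep′ (SeedCorners-transpose (G π) (corners π h)) ,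
    tableaux-cong {G₁ = G (flip π)} {transpose (G π)} (Represents⇒Λ≡ (rep (flip π)) rep′)
    where
    rep′ : Represents (transpose (G π)) (flip π)
    rep′ = transpose-represents (rep π)

theorem1p1 : (n d L : ℕ) → 1 ≤ n → 1 ≤ d → 1 ≤ L →
  Σ ((π : Permutation′ n) → InS n d L π → TabPair n d) λ Φ →
    -- Φ lands in 𝒯_n^{(d,L)}
    (∀ π (h : InS n d L π) → InT n d L (Φ π h))
    -- Φ is well defined on permutations (respects equality of permutations)
    × (∀ π σ (h : InS n d L π) (h' : InS n d L σ) → π ≈ σ → Φ π h ≡ Φ σ h')
    -- Φ is injective
    × (∀ π σ (h : InS n d L π) (h' : InS n d L σ) → Φ π h ≡ Φ σ h' → π ≈ σ)
    -- Φ is surjective onto 𝒯_n^{(d,L)}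
    × (∀ PQ → InT n d L PQ → Σ (Permutation′ n) λ π → Σ (InS n d L π) λ h → Φ π h ≡ PQ)
    -- π⁻¹ ∈ S_n^{(d,L)} and Φ(π⁻¹) = (Q , P) when Φ(π) = (P , Q)
    × (∀ π (h : InS n d L π) →
         Σ (InS n d L (flip π)) λ h' → Φ (flip π) h' ≡ swapPair (Φ π h))
theorem1p1 n (suc e) (suc L) _ _ _ = Φ , Φ-InT , Φ-cong , Φ-injective , Φ-surjective , Φ-flip
  where open Bijection {n} {e} {L} (λ π → permutationGrowth π e) (λ π → permutationGrowth-represents π e)
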